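{- For every string $\Xi$ in the following sets, the graph $G(\Xi)$ is a long-refinement graph, i.e.\ $\mathrm{WL}_1(G(\Xi)) = |G(\Xi)|-1$: (1) $\{\mathrm{S011XX}\}$; (2) $\{\mathrm{S}1^k001^k\mathrm{X}1\mathrm{X}1^k0 \mid k \in \mathbb{N}_0\}$; (3) $\{\mathrm{S}1^k11001^k\mathrm{XX}1^k0 \mid k \in \mathbb{N}_0\}$; (4) $\{\mathrm{S}1^k0011^k\mathrm{XX}1^k10 \mid k \in \mathbb{N}_0\}$; (5) $\{\mathrm{S}011(011)^k00(110)^k\mathrm{XX}(011)^k0 \mid k \in \mathbb{N}_0\}$; (6) $\{\mathrm{S}(011)^k00(110)^k1\mathrm{X}0\mathrm{X}1(011)^k0 \mid k \in \mathbb{N}_0\}$.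
   Context: All graphs are finite, simple, undirected, with monochromatic initial colouring. Colour Refinement computes $\chi^0_G$ constant and $\chi^i_G(v) = \big(\chi^{i-1}_G(v), \{\!\{\chi^{i-1}_G(w) \mid w \in N(v)\}\!\}\big)$; $\pi^i_G$ is the partition of $V(G)$ into colour classes of $\chi^i_G$, and $\mathrm{WL}_1(G)$ is the least $j \geq 0$ with $\pi^j_G = \pi^{j+1}_G$. A long-refinement graph is a graph $G$ with $\mathrm{WL}_1(G) = |G|-1$. For a word $w$, $(w)^k$ is the $k$-fold concatenation of $w$ and $1^k = (1)^k$. For $\ell \geq 3$ and a string $\Xi\colon [\ell] \to \{0,1,\mathrm{S},\mathrm{X}\}$ with $\Xi(1) = \mathrm{S}$, no other S, and exactly two positions $r < r'$ with $\Xi(r) = \Xi(r') = \mathrm{X}$, the graph $G(\Xi)$ has vertex set $\{v_{i,j} \mid i \in [\ell], j \in [2]\}$ and edge set consisting of: $\{v_{i,1},v_{i,2}\}$ for every $i \in [\ell]$ with $\Xi(i)=1$; $\{v_{i,j},v_{i+1,j}\}$ for $i \in [\ell-1]$, $j \in [2]$; $\{v_{r,j}, v_{1,1}\}$ for $j\in[2]$; $\{v_{r',j}, v_{1,2}\}$ for $j \in [2]$; and additionally the edge $\{v_{\ell,1}, v_{\ell,2}\}$ (in all strings listed, the last letter is $0$ or X). -}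

module Defs where

open import Data.Bool using (Bool; true; false; _∧_; _∨_; if_then_else_)
open import Data.Nat using (ℕ; zero; suc; _+_; _*_; _∸_; _<_; _≡ᵇ_; _/_; _%_)
open import Data.Fin using (Fin; toℕ)
open import Data.List using (List; []; _∷_; length; replicate; concat; _++_; lookup; take; filter)
open import Data.List.Base using (allFin)
import Data.List as L
open import Data.Product using (_×_)
open import Relation.Binary.PropositionalEquality using (_≡_)
open import Relation.Nullary using (¬_)

record Graph : Set where
  field
    n   : ℕ
    adj : Fin n → Fin n → Bool
open Graph public

order : Graph → ℕ
order G = n G

-- Colour refinement, monochromatic start.
-- sameColour G i v w = true  iff  χ^i_G(v) = χ^i_G(w).
-- χ^{i+1}(v) = χ^{i+1}(w) iff χ^i(v) = χ^i(w) and the multisets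
-- {{χ^i(x) | x ∈ N(v)}} and {{χ^i(x) | x ∈ N(w)}} coincide, i.e. for every
-- colour class (represented by a vertex u) both v and w have the same number
-- of neighbours of that colour.

count : ∀ {m} → (Fin m → Bool) → ℕ
count {m} p = length (filter (λ x → Data.Bool._≟_ (p x) true) (allFin m))
  where import Data.Bool

allB : ∀ {A : Set} → (A → Bool) → List A → Bool
allB p []       = true
allB p (x ∷ xs) = p x ∧ allB p xs

mutual
  sameColour : (G : Graph) → ℕ → Fin (n G) → Fin (n G) → Bool
  sameColour G zero    v w = true
  sameColour G (suc i) v w =
    sameColour G i v w ∧ allB (λ u → nbCount G i v u ≡ᵇ nbCount G i w u) (allFin (n G))

  nbCount : (G : Graph) → ℕ → Fin (n G) → Fin (n G) → ℕ
  nbCount G i v u = count (λ x → adj G v x ∧ sameColour G i x u)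

Stable : Graph → ℕ → Set
Stable G j = ∀ v w → sameColour G j v w ≡ sameColour G (suc j) v w

WL1≡ : Graph → ℕ → Set
WL1≡ G j = Stable G j × (∀ i → i < j → ¬ Stable G i)

LongRefinement : Graph → Set
LongRefinement G = WL1≡ G (order G ∸ 1)

data Letter : Set where
  S O I X : Letter   -- O = letter 0, I = letter 1

isX : Letter → Bool
isX X = true
isX _ = false

isOne : Letter → Bool
isOne I = true
isOne _ = false

-- letter at (0-based) position i; S outside the range (never used there)
at : List Letter → ℕ → Letter
at []       _       = S
at (a ∷ _)  zero    = a
at (_ ∷ as) (suc i) = at as i

xsBefore : List Letter → ℕ → ℕ
xsBefore as i = L.length (L.filter (λ a → Data.Bool._≟_ (isX a) true) (take i as))
  where import Data.Bool

-- Positions are 0-based: position p (0 ≤ p < ℓ) is the paper's position p+1,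
-- column c ∈ {0,1} is the paper's j = c+1.
-- Edge predicate on (p,c) – (q,d), one direction; symmetrised below.
-- r  = position of the first X  (joined to v_{1,1} = (0,0)),
-- r' = position of the second X (joined to v_{1,2} = (0,1)).
edgeDir : List Letter → ℕ → ℕ → ℕ → ℕ → Bool
edgeDir Ξ p c q d =
     ((p ≡ᵇ q) ∧ (c ≡ᵇ 0) ∧ (d ≡ᵇ 1) ∧ (isOne (at Ξ p) ∨ (suc p ≡ᵇ length Ξ)))
  ∨ ((suc p ≡ᵇ q) ∧ (c ≡ᵇ d))
  ∨ ((q ≡ᵇ 0) ∧ (d ≡ᵇ 0) ∧ isX (at Ξ p) ∧ (xsBefore Ξ p ≡ᵇ 0))
  ∨ ((q ≡ᵇ 0) ∧ (d ≡ᵇ 1) ∧ isX (at Ξ p) ∧ (xsBefore Ξ p ≡ᵇ 1))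

-- vertex k ∈ Fin (2ℓ) is v_{(k / 2)+1, (k % 2)+1}
adjΞ : (Ξ : List Letter) → Fin (length Ξ * 2) → Fin (length Ξ * 2) → Bool
adjΞ Ξ u v =
  edgeDir Ξ (toℕ u / 2) (toℕ u % 2) (toℕ v / 2) (toℕ v % 2)
  ∨ edgeDir Ξ (toℕ v / 2) (toℕ v % 2) (toℕ u / 2) (toℕ u % 2)

G : List Letter → Graph
G Ξ = record { n = length Ξ * 2 ; adj = adjΞ Ξ }

1^ : ℕ → List Letter
1^ k = replicate k I

_^^_ : List Letter → ℕ → List Letter
w ^^ k = concat (replicate k w)

{-# OPTIONS --safe #-}

-- The proof writes down the complete run of Colour Refinement, in which every step splits exactly
-- one colour class.  As long as only one class is split, the next step is decided by the number of
-- neighbours in one of its two parts.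
-- For G(Ξ) the classes are first unions of levels {v_{p,1}, v_{p,2}}.  Give every level a label, such
-- that the two arms before the first X, the arm after the second X and the letters around them are
-- folded onto one path.  Starting from the degrees, labels 0, 1, …, m are split off one after
-- the other; after label m the class of a level s breaks, and the wave runs back along the path,
-- making the levels s, s + 1, …, r singletons, where r is the first X.  Now the two X levels are told
-- apart, hence so are v_{1,1} and v_{1,2}, and finally the levels split into vertices from left to right.

module Submission where

open import Defs hiding (n)
open import Algebra.Properties.CommutativeSemigroup using (interchange)
open import Data.Bool using (Bool; true; false; _∧_; _∨_; not; T; if_then_else_)
import Data.Bool as 𝔹
import Data.Bool.Properties as 𝔹ₚ
open import Data.Empty using (⊥-elim)
open import Data.Fin using (Fin; toℕ; fromℕ<)
open import Data.Fin.Properties using (toℕ-injective; toℕ<n; toℕ-fromℕ<)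
open import Data.List using (List; []; _∷_; _++_; length; map; filter; allFin; null; downFrom; drop)
open import Data.List.Properties using (length-map; map-++; length-++; length-downFrom; ++-assoc; ++-identityʳ)
open import Data.List.Membership.Propositional using (_∈_)
open import Data.List.Membership.Propositional.Properties
  using (∈-filter⁺; ∈-filter⁻; ∈-allFin; ∈-map⁺; ∈-map⁻; ∈-++⁺ˡ; ∈-++⁺ʳ; ∈-++⁻)
open import Data.List.Membership.Propositional.Properties.WithK using (unique∧set⇒bag)
open import Data.List.Relation.Unary.Any using (here; there)
open import Data.List.Relation.Unary.All as All using (All; []; _∷_)
open import Data.List.Relation.Unary.All.Properties using (++⁻ˡ; ++⁻ʳ) renaming (++⁺ to All-++⁺)
open import Data.List.Relation.Unary.AllPairs using ([]; _∷_)
open import Data.List.Relation.Unary.Unique.Propositional using (Unique)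
import Data.List.Relation.Unary.Unique.Propositional.Properties as Unique
open import Data.List.Relation.Binary.BagAndSetEquality using (∼bag⇒↭)
open import Data.List.Relation.Binary.Permutation.Propositional.Properties using (↭-length)
open import Data.Nat using (ℕ; zero; suc; pred; _+_; _*_; _∸_; _<_; _≤_; z≤n; s≤s; z<s; s<s; _≡ᵇ_; _<ᵇ_; _≤ᵇ_; _/_; _%_)
open import Data.Nat.Properties
open import Data.Nat.Divisibility using (n∣m*n)
open import Data.Nat.DivMod
  using (m%n<n; m≡m%n+[m/n]*n; m<n*o⇒m/o<n; [m+kn]%n≡m%n; m<n⇒m%n≡m; +-distrib-/-∣ʳ; m<n⇒m/n≡0; m*n/n≡m)
open import Data.Nat.Solver using (module +-*-Solver)
open import Data.Product using (∃; _×_; _,_; proj₁; proj₂)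
open import Data.Sum using (_⊎_; inj₁; inj₂)
open import Data.Unit using (⊤; tt)
open import Function using (_∘_; _⇔_; mk⇔; Equivalence)
open import Relation.Binary.Definitions using (tri<; tri≈; tri>)
open import Relation.Binary.PropositionalEquality
open import Relation.Nullary using (¬_; Dec)
open import Relation.Nullary.Decidable using (from-yes)

open Equivalence using (to; from)

-- Colour refinement with one split per step

-- A graph on N vertices starts with one class and can reach at most N, so N - 1 rounds leave room
-- for only one new class per round; this is why every step must break exactly one class into two.
-- The labels do not see the columns, because both X levels carry the same label although level 0
-- reaches one of them from each column. The symmetry between the columns lasts until the two X
-- levels are separated. In the infinite families, the levels behind the first X carry each small
-- label exactly once; they are the partners from which the wave separates the earlier levels. The
-- parameter affects only the arms, where every label meets its successor in the same way. The
-- remaining levels have labels above the arm length n and are checked as offsets from n, a finite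
-- computation that does not depend on n. The pair 00 where two arms meet and the last level with
-- its extra rung look alike to the labels: in both, a level labelled 0 is adjacent to a level
-- labelled 0.

b2n : Bool → ℕ
b2n true  = 1
b2n false = 0

bool-ext : ∀ {a b : Bool} → (a ≡ true → b ≡ true) → (b ≡ true → a ≡ true) → a ≡ b
bool-ext {true}  {true}  f g = refl
bool-ext {true}  {false} f g = sym (f refl)
bool-ext {false} {true}  f g = g refl
bool-ext {false} {false} f g = refl

∧≡true : ∀ {a b} → a ∧ b ≡ true → a ≡ true × b ≡ true
∧≡true {true} {true} _ = refl , refl

true∧true : ∀ {a b} → a ≡ true → b ≡ true → a ∧ b ≡ true
true∧true refl refl = refl

≡ᵇ-true : ∀ {m n} → (m ≡ᵇ n) ≡ true → m ≡ n
≡ᵇ-true {m} {n} e = ≡ᵇ⇒≡ m n (subst T (sym e) tt)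

≡ᵇ-refl : ∀ m → (m ≡ᵇ m) ≡ true
≡ᵇ-refl zero    = refl
≡ᵇ-refl (suc m) = ≡ᵇ-refl m

≢⇒≡ᵇ : ∀ {m n} → m ≢ n → (m ≡ᵇ n) ≡ false
≢⇒≡ᵇ {m} {n} ne with m ≡ᵇ n in e
... | false = refl
... | true  = ⊥-elim (ne (≡ᵇ-true e))

tally : {A : Set} → (A → Bool) → List A → ℕ
tally p []       = 0
tally p (x ∷ xs) = b2n (p x) + tally p xs

length-filter≡tally : {A : Set} (p : A → Bool) (xs : List A) →
  length (filter (λ x → p x 𝔹.≟ true) xs) ≡ tally p xs
length-filter≡tally p [] = refl
length-filter≡tally p (x ∷ xs) with p x
... | true  = cong suc (length-filter≡tally p xs)
... | false = length-filter≡tally p xs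

tally-cong : {A : Set} {p q : A → Bool} → (∀ x → p x ≡ q x) → ∀ xs → tally p xs ≡ tally q xs
tally-cong e []       = refl
tally-cong e (x ∷ xs) = cong₂ _+_ (cong b2n (e x)) (tally-cong e xs)

tally-false : {A : Set} {p : A → Bool} → (∀ x → p x ≡ false) → ∀ xs → tally p xs ≡ 0
tally-false e []       = refl
tally-false e (x ∷ xs) rewrite e x = tally-false e xs

tally-split : {A : Set} {p q r : A → Bool} → (∀ x → b2n (p x) ≡ b2n (q x) + b2n (r x)) →
  ∀ xs → tally p xs ≡ tally q xs + tally r xs
tally-split e [] = refl
tally-split {p = p} {q} {r} e (x ∷ xs) rewrite e x | tally-split e xs =
  interchange +-commutativeSemigroup (b2n (q x)) (b2n (r x)) (tally q xs) (tally r xs)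

allB-true : {A : Set} {p : A → Bool} (xs : List A) → (∀ x → p x ≡ true) → allB p xs ≡ true
allB-true []       h = refl
allB-true (x ∷ xs) h = true∧true (h x) (allB-true xs h)

allB-∈ : {A : Set} {p : A → Bool} {x : A} (xs : List A) → allB p xs ≡ true → x ∈ xs → p x ≡ true
allB-∈ (y ∷ ys) h (here refl) = proj₁ (∧≡true h)
allB-∈ (y ∷ ys) h (there i)   = allB-∈ ys (proj₂ (∧≡true h)) i

module Refinement (H : Graph) where

  V : Set
  V = Fin (order H)

  degreeIn : (V → Bool) → V → ℕ
  degreeIn A v = count (λ x → adj H v x ∧ A x)

  degreeIn≡tally : ∀ A v → degreeIn A v ≡ tally (λ x → adj H v x ∧ A x) (allFin (order H))
  degreeIn≡tally A v = length-filter≡tally (λ x → adj H v x ∧ A x) (allFin (order H))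

  degreeIn-cong : ∀ {A B} → (∀ x → A x ≡ B x) → ∀ v → degreeIn A v ≡ degreeIn B v
  degreeIn-cong {A} {B} e v rewrite degreeIn≡tally A v | degreeIn≡tally B v =
    tally-cong (λ x → cong (adj H v x ∧_) (e x)) (allFin (order H))

  degreeIn-split : ∀ {A B C} → (∀ x → b2n (A x) ≡ b2n (B x) + b2n (C x)) →
    ∀ v → degreeIn A v ≡ degreeIn B v + degreeIn C v
  degreeIn-split {A} {B} {C} e v
    rewrite degreeIn≡tally A v | degreeIn≡tally B v | degreeIn≡tally C v =
    tally-split under-adj (allFin (order H))
    where
    under-adj : ∀ x → b2n (adj H v x ∧ A x) ≡ b2n (adj H v x ∧ B x) + b2n (adj H v x ∧ C x)
    under-adj x with adj H v x
    ... | true  = e x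
    ... | false = refl

  SameNb : ℕ → V → V → Set
  SameNb t v w = ∀ u → nbCount H t v u ≡ nbCount H t w u

  same-suc : ∀ t v w → sameColour H (suc t) v w ≡ true ⇔ (sameColour H t v w ≡ true × SameNb t v w)
  same-suc t v w = mk⇔
    (λ e → proj₁ (∧≡true e) , λ u → ≡ᵇ-true (allB-∈ (allFin (order H)) (proj₂ (∧≡true e)) (∈-allFin u)))
    (λ (e , f) → true∧true e (allB-true (allFin (order H)) λ u → nb u (f u)))
    where
    nb : ∀ u → nbCount H t v u ≡ nbCount H t w u → (nbCount H t v u ≡ᵇ nbCount H t w u) ≡ true
    nb u e rewrite e = ≡ᵇ-refl (nbCount H t w u)

  same-trans : ∀ t {a b c} → sameColour H t a b ≡ true → sameColour H t b c ≡ true → sameColour H t a c ≡ true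
  same-trans zero    e f = refl
  same-trans (suc t) {a} {b} {c} e f =
    let e₁ , e₂ = to (same-suc t a b) e ; f₁ , f₂ = to (same-suc t b c) f in
    from (same-suc t a c) (same-trans t e₁ f₁ , λ u → trans (e₂ u) (f₂ u))

  -- The partition at time t is R; since it arose from its predecessor by splitting a single class,
  -- one part of which is A, the next refinement step only has to compare the degrees into A.
  record Refined (t : ℕ) (R : V → V → Set) (A : V → Bool) : Set where
    field
      now     : ∀ v w → sameColour H t v w ≡ true ⇔ R v w
      next    : ∀ v w → sameColour H (suc t) v w ≡ true ⇔ (R v w × degreeIn A v ≡ degreeIn A w)
      earlier : ∀ i → i < t → ¬ Stable H i
  open Refined

  -- Nothing has been split yet, so the part to be counted is the whole vertex set and the first
  -- round compares degrees.
  refined-start : Refined 0 (λ _ _ → ⊤) (λ _ → true)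
  refined-start .now  v w = mk⇔ (λ _ → tt) (λ _ → refl)
  refined-start .next v w = mk⇔
    (λ e → tt , proj₂ (to (same-suc 0 v w) e) v)
    (λ (_ , e) → from (same-suc 0 v w) (refl , λ _ → e))
  refined-start .earlier _ ()

  refined-resp : ∀ {t R R′ A A′} → (∀ v w → R v w ⇔ R′ v w) → (∀ v → A v ≡ A′ v) →
    Refined t R A → Refined t R′ A′
  refined-resp h e r = record
    { now     = λ v w → mk⇔ (to (h v w) ∘ to (now r v w)) (from (now r v w) ∘ from (h v w))
    ; next    = λ v w → mk⇔
        (λ s → let x , y = to (next r v w) s in
               to (h v w) x , trans (sym (degreeIn-cong e v)) (trans y (degreeIn-cong e w)))
        (λ (x , y) → from (next r v w)
               (from (h v w) x , trans (degreeIn-cong e v) (trans y (sym (degreeIn-cong e w)))))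
    ; earlier = earlier r
    }

  refined-stable : ∀ {t R A} → Refined t R A → (∀ v w → R v w → degreeIn A v ≡ degreeIn A w) → WL1≡ H t
  refined-stable r h =
    (λ v w → bool-ext
      (λ e → from (next r v w) (to (now r v w) e , h v w (to (now r v w) e)))
      (λ e → from (now r v w) (proj₁ (to (next r v w) e))))
    , earlier r

  -- Vertices that share a class at time `t + 1` have equally many neighbours in every class of time
  -- `t`. Only one of those classes breaks, into `B` and a remainder, so the count in `B` fixes the
  -- count in the remainder as well. The second hypothesis places `B` inside one class; the last one
  -- makes the break proper, so that time `t` is not stable.
  refined-step : ∀ {t R A} (B : V → Bool) → Refined t R A →
    (∀ v w → R v w → degreeIn A v ≡ degreeIn A w ⇔ B v ≡ B w) →
    (∀ v w → B v ≡ true → B w ≡ true → R v w) →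
    (∃ λ v → ∃ λ w → B v ≡ true × B w ≡ false × R v w) →
    Refined (suc t) (λ v w → R v w × B v ≡ B w) B
  refined-step {t} {R} {A} B r splits within (v₀ , w₀ , v₀∈B , w₀∉B , v₀~w₀) = record
    { now = now′ ; next = λ v w → mk⇔ (next⇒ v w) (next⇐ v w) ; earlier = earlier′ }
    where
    now′ : ∀ v w → sameColour H (suc t) v w ≡ true ⇔ (R v w × B v ≡ B w)
    now′ v w = mk⇔
      (λ e → let x , y = to (next r v w) e in x , to (splits v w x) y)
      (λ (x , y) → from (next r v w) (x , from (splits v w x) y))

    earlier′ : ∀ i → i < suc t → ¬ Stable H i
    earlier′ i (s≤s i≤t) st with m≤n⇒m<n∨m≡n i≤t
    ... | inj₁ i<t  = earlier r i i<t st
    ... | inj₂ refl with trans (sym (proj₂ (to (now′ v₀ w₀) (trans (sym (st v₀ w₀)) (from (now r v₀ w₀) v₀~w₀))))) v₀∈B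
    ...   | w₀∈B with trans (sym w₀∈B) w₀∉B
    ...     | ()

    class-B : ∀ {u} → B u ≡ true → ∀ x → sameColour H (suc t) x u ≡ B x
    class-B {u} u∈B x = bool-ext
      (λ e → trans (proj₂ (to (now′ x u) e)) u∈B)
      (λ e → from (now′ x u) (within x u e u∈B , trans e (sym u∈B)))

    -- A class other than that of `v₀` does not meet `B` and survives unchanged.
    class-far : ∀ {u} → B u ≡ false → sameColour H t v₀ u ≡ false → ∀ x →
      sameColour H t x u ≡ sameColour H (suc t) x u
    class-far {u} u∉B v₀≁u x = bool-ext
      (λ e → from (now′ x u) (to (now r x u) e , trans (x∉B e) (sym u∉B)))
      (λ e → from (now r x u) (proj₁ (to (now′ x u) e)))
      where
      x∉B : sameColour H t x u ≡ true → B x ≡ false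
      x∉B x~u with B x in x∈B
      ... | false = refl
      ... | true with trans (sym v₀≁u) (same-trans t (from (now r v₀ x) (within v₀ x v₀∈B x∈B)) x~u)
      ...   | ()

    -- The class that breaks is the disjoint union of its remainder and `B`, stated numerically so
    -- that `degreeIn-split` applies.
    class-near : ∀ {u} → B u ≡ false → sameColour H t v₀ u ≡ true → ∀ x →
      b2n (sameColour H t x u) ≡ b2n (sameColour H (suc t) x u) + b2n (B x)
    class-near {u} u∉B v₀~u x = go (B x) refl
      where
      go : ∀ b → B x ≡ b → b2n (sameColour H t x u) ≡ b2n (sameColour H (suc t) x u) + b2n b
      go false bx = trans (cong b2n (bool-ext
        (λ e → from (now′ x u) (to (now r x u) e , trans bx (sym u∉B)))
        (λ e → from (now r x u) (proj₁ (to (now′ x u) e))))) (sym (+-identityʳ _))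
      go true bx = trans
        (cong b2n (same-trans t (from (now r x v₀) (within x v₀ bx v₀∈B)) v₀~u))
        (sym (cong (λ z → b2n z + 1) (𝔹ₚ.¬-not λ e →
          𝔹ₚ.not-¬ refl (trans (sym bx) (trans (proj₂ (to (now′ x u) e)) u∉B)))))

    next⇒ : ∀ v w → sameColour H (suc (suc t)) v w ≡ true →
      (R v w × B v ≡ B w) × degreeIn B v ≡ degreeIn B w
    next⇒ v w e = let x , y = to (same-suc (suc t) v w) e in to (now′ v w) x ,
      trans (sym (degreeIn-cong (class-B v₀∈B) v)) (trans (y v₀) (degreeIn-cong (class-B v₀∈B) w))

    next⇐ : ∀ v w → (R v w × B v ≡ B w) × degreeIn B v ≡ degreeIn B w →
      sameColour H (suc (suc t)) v w ≡ true
    next⇐ v w (x , eB) = from (same-suc (suc t) v w) (from (now′ v w) x , nb)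
      where
      nb-before : SameNb t v w
      nb-before = proj₂ (to (same-suc t v w) (from (now′ v w) x))
      nb : SameNb (suc t) v w
      nb u with B u in bu | sameColour H t v₀ u in near
      ... | true  | _     = trans (degreeIn-cong (class-B bu) v) (trans eB (sym (degreeIn-cong (class-B bu) w)))
      ... | false | false = trans (sym (degreeIn-cong (class-far bu near) v))
                              (trans (nb-before u) (degreeIn-cong (class-far bu near) w))
      ... | false | true  = +-cancelʳ-≡ (degreeIn B w) _ _ (begin
        nbCount H (suc t) v u + degreeIn B w ≡⟨ cong (nbCount H (suc t) v u +_) (sym eB) ⟩
        nbCount H (suc t) v u + degreeIn B v ≡⟨ sym (degreeIn-split (class-near bu near) v) ⟩
        nbCount H t v u                      ≡⟨ nb-before u ⟩
        nbCount H t w u                      ≡⟨ degreeIn-split (class-near bu near) w ⟩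
        nbCount H (suc t) w u + degreeIn B w ∎)
        where open ≡-Reasoning

-- Neighbourhoods in G(Ξ)

true≢false : {A : Set} {b : Bool} → b ≡ true → b ≡ false → A
true≢false refl ()

∨≡true : ∀ {a b} → a ∨ b ≡ true → a ≡ true ⊎ b ≡ true
∨≡true {true}  _ = inj₁ refl
∨≡true {false} e = inj₂ e

∨-trueˡ : ∀ {a b} → a ≡ true → a ∨ b ≡ true
∨-trueˡ refl = refl

∨-trueʳ : ∀ {a b} → b ≡ true → a ∨ b ≡ true
∨-trueʳ {true}  _ = refl
∨-trueʳ {false} e = e

<⇒<ᵇ≡true : ∀ {m n} → m < n → (m <ᵇ n) ≡ true
<⇒<ᵇ≡true {m} {n} h with m <ᵇ n in e
... | true  = refl
... | false = ⊥-elim (subst T e (<⇒<ᵇ h))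

<ᵇ≡true⇒< : ∀ {m n} → (m <ᵇ n) ≡ true → m < n
<ᵇ≡true⇒< {m} {n} e = <ᵇ⇒< m n (subst T (sym e) tt)

when : {A : Set} → Bool → A → List A
when true  x = x ∷ []
when false x = []

when⁺ : {A : Set} {b : Bool} {x : A} → b ≡ true → x ∈ when b x
when⁺ refl = here refl

when⁻ : {A : Set} {b : Bool} {x y : A} → y ∈ when b x → b ≡ true × y ≡ x
when⁻ {b = true} (here e) = refl , e

All-when : {A : Set} {P : A → Set} (b : Bool) {x : A} → (b ≡ true → P x) → All P (when b x)
All-when true  h = h refl ∷ []
All-when false h = []

tally-++ : {A : Set} (p : A → Bool) (xs ys : List A) → tally p (xs ++ ys) ≡ tally p xs + tally p ys
tally-++ p []       ys = refl
tally-++ p (x ∷ xs) ys rewrite tally-++ p xs ys = sym (+-assoc (b2n (p x)) _ _)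

tally-when : {A : Set} (p : A → Bool) (b : Bool) (x : A) → tally p (when b x) ≡ b2n (b ∧ p x)
tally-when p true  x = +-identityʳ _
tally-when p false x = refl

<2⇒ : ∀ {c} → c < 2 → c ≡ 0 ⊎ c ≡ 1
<2⇒ {0} _ = inj₁ refl
<2⇒ {1} _ = inj₂ refl
<2⇒ {suc (suc _)} (s≤s (s≤s ()))

-- Vertices as pairs of a level and a column

module Coordinates (ℓ : ℕ) where

  pos col : Fin (ℓ * 2) → ℕ
  pos v = toℕ v / 2
  col v = toℕ v % 2

  pos< : ∀ v → pos v < ℓ
  pos< v = m<n*o⇒m/o<n (toℕ<n v)

  col< : ∀ v → col v < 2
  col< v = m%n<n (toℕ v) 2

  coords : Fin (ℓ * 2) → ℕ × ℕ
  coords v = pos v , col v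

  coords-injective : ∀ {v w} → coords v ≡ coords w → v ≡ w
  coords-injective {v} {w} e = toℕ-injective (begin
    toℕ v                  ≡⟨ m≡m%n+[m/n]*n (toℕ v) 2 ⟩
    col v + pos v * 2      ≡⟨ cong₂ (λ c p → c + p * 2) (cong proj₂ e) (cong proj₁ e) ⟩
    col w + pos w * 2      ≡⟨ sym (m≡m%n+[m/n]*n (toℕ w) 2) ⟩
    toℕ w                  ∎)
    where open ≡-Reasoning

  coords-surjective : ∀ {p c} → p < ℓ → c < 2 → ∃ λ v → coords v ≡ (p , c)
  coords-surjective {p} {c} p<ℓ c<2 = fromℕ< c+2p< , cong₂ _,_ pos≡ col≡
    where
    c+2p< : c + p * 2 < ℓ * 2
    c+2p< = <-≤-trans (+-monoˡ-< (p * 2) c<2) (*-monoˡ-≤ 2 p<ℓ)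
    pos≡ : toℕ (fromℕ< c+2p<) / 2 ≡ p
    pos≡ = begin
      toℕ (fromℕ< c+2p<) / 2 ≡⟨ cong (_/ 2) (toℕ-fromℕ< c+2p<) ⟩
      (c + p * 2) / 2        ≡⟨ +-distrib-/-∣ʳ c (n∣m*n p) ⟩
      c / 2 + p * 2 / 2      ≡⟨ cong₂ _+_ (m<n⇒m/n≡0 c<2) (m*n/n≡m p 2) ⟩
      p                      ∎
      where open ≡-Reasoning
    col≡ : toℕ (fromℕ< c+2p<) % 2 ≡ c
    col≡ = begin
      toℕ (fromℕ< c+2p<) % 2 ≡⟨ cong (_% 2) (toℕ-fromℕ< c+2p<) ⟩
      (c + p * 2) % 2        ≡⟨ [m+kn]%n≡m%n c p 2 ⟩
      c % 2                  ≡⟨ m<n⇒m%n≡m c<2 ⟩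
      c                      ∎
      where open ≡-Reasoning

-- `1<r` keeps the letters X away from level 1, so that no spoke coincides with the rail from level
-- 1 to level 0. The number of letters X to the left of an X doubles as the column where its spokes
-- end: 0 for the first, 1 for the second.
record Ladder (Ξ : List Letter) : Set where
  field
    r r′    : ℕ
    1<r     : 1 < r
    r<r′    : r < r′
    r′<ℓ    : r′ < length Ξ
    at-0    : at Ξ 0 ≡ S
    isX-r   : isX (at Ξ r) ≡ true
    xs-r    : xsBefore Ξ r ≡ 0
    isX-r′  : isX (at Ξ r′) ≡ true
    xs-r′   : xsBefore Ξ r′ ≡ 1
    isX-inv : ∀ q → isX (at Ξ q) ≡ true → (q ≡ r × xsBefore Ξ q ≡ 0) ⊎ (q ≡ r′ × xsBefore Ξ q ≡ 1)

module Neighbourhoods {Ξ : List Letter} (lad : Ladder Ξ) where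
  open Ladder lad public

  ℓ : ℕ
  ℓ = length Ξ

  open Coordinates ℓ public
  open Refinement (G Ξ) public

  r<ℓ : r < ℓ
  r<ℓ = <-trans r<r′ r′<ℓ

  1<ℓ : 1 < ℓ
  1<ℓ = <-trans 1<r r<ℓ

  rung? : ℕ → Bool
  rung? p = isOne (at Ξ p) ∨ (suc p ≡ᵇ ℓ)

  data Arc : ℕ → ℕ → ℕ → ℕ → Set where
    rung : ∀ {p} → rung? p ≡ true → Arc p 0 p 1
    rail : ∀ {p c} → Arc p c (suc p) c
    spoke : ∀ {p c d} → isX (at Ξ p) ≡ true → xsBefore Ξ p ≡ d → Arc p c 0 d

  xs<2 : ∀ p → isX (at Ξ p) ≡ true → xsBefore Ξ p < 2
  xs<2 p x with isX-inv p x
  ... | inj₁ (_ , e) = subst (_< 2) (sym e) (s≤s z≤n)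
  ... | inj₂ (_ , e) = subst (_< 2) (sym e) (s≤s (s≤s z≤n))

  spoke-at : ∀ {p c q d} k →
    ((q ≡ᵇ 0) ∧ (d ≡ᵇ k) ∧ isX (at Ξ p) ∧ (xsBefore Ξ p ≡ᵇ k)) ≡ true → Arc p c q d
  spoke-at {p} {c} {q} {d} k h =
    let e₁ , h₁ = ∧≡true h ; e₂ , h₂ = ∧≡true h₁ ; e₃ , e₄ = ∧≡true h₂ in
    subst (λ q → Arc p c q d) (sym (≡ᵇ-true {q} e₁))
      (spoke e₃ (trans (≡ᵇ-true {xsBefore Ξ p} e₄) (sym (≡ᵇ-true {d} e₂))))

  edgeDir⇒Arc : ∀ p c q d → edgeDir Ξ p c q d ≡ true → Arc p c q d
  edgeDir⇒Arc p c q d h with ∨≡true h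
  ... | inj₁ h₁ =
    let e₁ , h₂ = ∧≡true h₁ ; e₂ , h₃ = ∧≡true h₂ ; e₃ , e₄ = ∧≡true h₃ in
    subst (λ (c , q , d) → Arc p c q d)
      (sym (cong₂ _,_ (≡ᵇ-true {c} e₂) (cong₂ _,_ (sym (≡ᵇ-true {p} e₁)) (≡ᵇ-true {d} e₃)))) (rung e₄)
  ... | inj₂ h₁ with ∨≡true h₁
  ...   | inj₁ h₂ = let e₁ , e₂ = ∧≡true h₂ in
    subst (λ (q , d) → Arc p c q d) (cong₂ _,_ (≡ᵇ-true {suc p} e₁) (≡ᵇ-true {c} e₂)) rail
  ...   | inj₂ h₂ with ∨≡true h₂
  ...     | inj₁ h₃ = spoke-at 0 h₃
  ...     | inj₂ h₃ = spoke-at 1 h₃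

  Arc⇒edgeDir : ∀ {p c q d} → Arc p c q d → edgeDir Ξ p c q d ≡ true
  Arc⇒edgeDir {p} (rung e) rewrite ≡ᵇ-refl p | e = refl
  Arc⇒edgeDir {p} {c} rail =
    ∨-trueʳ {(p ≡ᵇ suc p) ∧ (c ≡ᵇ 0) ∧ (c ≡ᵇ 1) ∧ rung? p}
      (∨-trueˡ (true∧true (≡ᵇ-refl p) (≡ᵇ-refl c)))
  Arc⇒edgeDir {p} {c} {q} {d} (spoke x e) =
    ∨-trueʳ {(p ≡ᵇ 0) ∧ (c ≡ᵇ 0) ∧ (d ≡ᵇ 1) ∧ rung? p} (spoke′ (<2⇒ (subst (_< 2) e (xs<2 p x))))
    where
    spoke′ : d ≡ 0 ⊎ d ≡ 1 →
      ((d ≡ᵇ 0) ∧ isX (at Ξ p) ∧ (xsBefore Ξ p ≡ᵇ 0)) ∨ ((d ≡ᵇ 1) ∧ isX (at Ξ p) ∧ (xsBefore Ξ p ≡ᵇ 1)) ≡ true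
    spoke′ (inj₁ refl) rewrite x | e = refl
    spoke′ (inj₂ refl) rewrite x | e = refl

  hub : ℕ → ℕ
  hub zero    = r
  hub (suc _) = r′

  nbs : ℕ → ℕ → List (ℕ × ℕ)
  nbs zero    c = (1 , c) ∷ (hub c , 0) ∷ (hub c , 1) ∷ []
  nbs (suc p) c = (p , c) ∷ when (2 + p <ᵇ ℓ) (2 + p , c)
    ++ when (rung? (suc p)) (suc p , 1 ∸ c)
    ++ when (isX (at Ξ (suc p))) (0 , xsBefore Ξ (suc p))

  no-rung-0 : rung? 0 ≡ false
  no-rung-0 rewrite at-0 = ≢⇒≡ᵇ {1} {ℓ} (<⇒≢ 1<ℓ)

  no-X-0 : isX (at Ξ 0) ≡ false
  no-X-0 rewrite at-0 = refl

  hub-xs : ∀ q c → isX (at Ξ q) ≡ true → xsBefore Ξ q ≡ c → q ≡ hub c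
  hub-xs q c x e with isX-inv q x
  ... | inj₁ (e₁ , e₂) = trans e₁ (cong hub (trans (sym e₂) e))
  ... | inj₂ (e₁ , e₂) = trans e₁ (cong hub (trans (sym e₂) e))

  nbs-sound : ∀ {p c q d} → q < ℓ → d < 2 → Arc p c q d ⊎ Arc q d p c → (q , d) ∈ nbs p c
  nbs-sound {zero} _ _ (inj₁ (rung e)) = true≢false e no-rung-0
  nbs-sound {zero} _ _ (inj₁ rail) = here refl
  nbs-sound {zero} _ _ (inj₁ (spoke x _)) = true≢false x no-X-0
  nbs-sound {zero} _ _ (inj₂ (rung e)) = true≢false e no-rung-0
  nbs-sound {zero} {c} {q} {d} _ d<2 (inj₂ (spoke x e)) with <2⇒ d<2
  ... | inj₁ refl = there (here (cong (_, 0) (hub-xs q c x e)))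
  ... | inj₂ refl = there (there (here (cong (_, 1) (hub-xs q c x e))))
  nbs-sound {suc p} _ _ (inj₁ (rung e)) =
    there (∈-++⁺ʳ (when (2 + p <ᵇ ℓ) _) (∈-++⁺ˡ (when⁺ e)))
  nbs-sound {suc p} q<ℓ _ (inj₁ rail) = there (∈-++⁺ˡ (when⁺ (<⇒<ᵇ≡true q<ℓ)))
  nbs-sound {suc p} _ _ (inj₁ (spoke x refl)) =
    there (∈-++⁺ʳ (when (2 + p <ᵇ ℓ) _) (∈-++⁺ʳ (when (rung? (suc p)) _) (when⁺ x)))
  nbs-sound {suc p} _ _ (inj₂ (rung e)) =
    there (∈-++⁺ʳ (when (2 + p <ᵇ ℓ) _) (∈-++⁺ˡ (when⁺ e)))
  nbs-sound {suc p} _ _ (inj₂ rail) = here refl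

  nbs-complete : ∀ {p c q d} → p < ℓ → c < 2 → (q , d) ∈ nbs p c →
    q < ℓ × d < 2 × (Arc p c q d ⊎ Arc q d p c)
  nbs-complete {zero} p<ℓ c<2 (here refl) = 1<ℓ , c<2 , inj₁ rail
  nbs-complete {zero} p<ℓ c<2 (there (here refl)) with <2⇒ c<2
  ... | inj₁ refl = r<ℓ , s≤s z≤n , inj₂ (spoke isX-r xs-r)
  ... | inj₂ refl = r′<ℓ , s≤s z≤n , inj₂ (spoke isX-r′ xs-r′)
  nbs-complete {zero} p<ℓ c<2 (there (there (here refl))) with <2⇒ c<2
  ... | inj₁ refl = r<ℓ , s≤s (s≤s z≤n) , inj₂ (spoke isX-r xs-r)
  ... | inj₂ refl = r′<ℓ , s≤s (s≤s z≤n) , inj₂ (spoke isX-r′ xs-r′)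
  nbs-complete {suc p} p<ℓ c<2 (here refl) = <-trans (n<1+n p) p<ℓ , c<2 , inj₂ rail
  nbs-complete {suc p} {c} p<ℓ c<2 (there i) with ∈-++⁻ (when (2 + p <ᵇ ℓ) _) i
  ... | inj₁ j with when⁻ j
  ...   | e , refl = <ᵇ≡true⇒< e , c<2 , inj₁ rail
  nbs-complete {suc p} {c} p<ℓ c<2 (there i) | inj₂ j with ∈-++⁻ (when (rung? (suc p)) _) j
  ... | inj₁ k with when⁻ k | <2⇒ c<2
  ...   | e , refl | inj₁ refl = p<ℓ , s≤s (s≤s z≤n) , inj₁ (rung e)
  ...   | e , refl | inj₂ refl = p<ℓ , s≤s z≤n , inj₂ (rung e)
  nbs-complete {suc p} {c} p<ℓ c<2 (there i) | inj₂ j | inj₂ k with when⁻ k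
  ... | x , refl = <-trans z<s p<ℓ , xs<2 (suc p) x , inj₁ (spoke x refl)

  nbs-unique : ∀ p c → Unique (nbs p c)
  nbs-unique zero c = (hub≢1 ∷ hub≢1 ∷ []) ∷ ((λ e → 0≢1+n (cong proj₂ e)) ∷ []) ∷ [] ∷ []
    where
    hub> : ∀ c → 1 < hub c
    hub> zero    = 1<r
    hub> (suc _) = <-trans 1<r r<r′
    hub≢1 : ∀ {e} → (1 , c) ≢ (hub c , e)
    hub≢1 e = <⇒≢ (hub> c) (cong proj₁ e)
  nbs-unique (suc p) c =
    All-++⁺ (All-when (2 + p <ᵇ ℓ) (λ _ e → m≢1+n+m p {1} (cong proj₁ e)))
      (All-++⁺ (All-when (rung? (suc p)) (λ _ e → m≢1+n+m p {0} (cong proj₁ e)))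
        (All-when (isX (at Ξ (suc p))) λ x e → p≢0 x (cong proj₁ e)))
    ∷ when-∷ (2 + p <ᵇ ℓ)
        (All-++⁺ (All-when (rung? (suc p)) (λ _ e → 1+n≢n (cong (pred ∘ proj₁) e)))
          (All-when (isX (at Ξ (suc p))) λ _ e → 1+n≢0 (cong proj₁ e)))
      (when-∷ (rung? (suc p)) (All-when (isX (at Ξ (suc p))) λ _ e → 1+n≢0 (cong proj₁ e))
        (when-unique (isX (at Ξ (suc p)))))
    where
    when-unique : {A : Set} (b : Bool) {x : A} → Unique (when b x)
    when-unique true  = [] ∷ []
    when-unique false = []
    when-∷ : {A : Set} (b : Bool) {x : A} {ys : List A} → All (x ≢_) ys → Unique ys → Unique (when b x ++ ys)
    when-∷ true  h u = h ∷ u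
    when-∷ false h u = u
    p≢0 : isX (at Ξ (suc p)) ≡ true → p ≢ 0
    p≢0 x refl with isX-inv 1 x
    ... | inj₁ (e , _) = <⇒≢ 1<r e
    ... | inj₂ (e , _) = <⇒≢ (<-trans 1<r r<r′) e

  lift : (ℕ → ℕ → Bool) → V → Bool
  lift A v = A (pos v) (col v)

  degreeAt : (ℕ → ℕ → Bool) → ℕ → ℕ → ℕ
  degreeAt A p c = tally (λ (q , d) → A q d) (nbs p c)

  -- After `coords`, the neighbours in `A` and the filtered explicit list have the same members.
  -- Both lists are free of duplicates, hence permutations of each other, and a degree becomes a sum
  -- over at most four entries.
  degreeIn≡nbs : ∀ (A : ℕ → ℕ → Bool) v →
    degreeIn (lift A) v ≡ degreeAt A (pos v) (col v)
  degreeIn≡nbs A v = begin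
    length (filter adjA? (allFin (order (G Ξ))))              ≡⟨ sym (length-map coords (filter adjA? (allFin (order (G Ξ))))) ⟩
    length (map coords (filter adjA? (allFin (order (G Ξ))))) ≡⟨ ↭-length (∼bag⇒↭ (unique∧set⇒bag
        (Unique.map⁺ coords-injective (Unique.filter⁺ adjA? (Unique.allFin⁺ (order (G Ξ)))))
        (Unique.filter⁺ A? (nbs-unique (pos v) (col v)))
        (mk⇔ ⇒ ⇐))) ⟩
    length (filter A? (nbs (pos v) (col v)))              ≡⟨ length-filter≡tally (λ (p , c) → A p c) (nbs (pos v) (col v)) ⟩
    degreeAt A (pos v) (col v)                            ∎
    where
    open ≡-Reasoning
    adjA? : (x : V) → Dec ((adj (G Ξ) v x ∧ lift A x) ≡ true)
    adjA? x = (adj (G Ξ) v x ∧ lift A x) 𝔹.≟ true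
    A? : (z : ℕ × ℕ) → Dec (A (proj₁ z) (proj₂ z) ≡ true)
    A? z = A (proj₁ z) (proj₂ z) 𝔹.≟ true
    ⇒ : ∀ {z} → z ∈ map coords (filter adjA? (allFin (order (G Ξ)))) → z ∈ filter A? (nbs (pos v) (col v))
    ⇒ i with ∈-map⁻ coords i
    ... | x , j , refl with ∧≡true (proj₂ (∈-filter⁻ adjA? {xs = allFin (order (G Ξ))} j))
    ...   | e , a with ∨≡true e
    ...     | inj₁ f = ∈-filter⁺ A? (nbs-sound (pos< x) (col< x) (inj₁ (edgeDir⇒Arc (pos v) (col v) (pos x) (col x) f))) a
    ...     | inj₂ f = ∈-filter⁺ A? (nbs-sound (pos< x) (col< x) (inj₂ (edgeDir⇒Arc (pos x) (col x) (pos v) (col v) f))) a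
    ⇐ : ∀ {z} → z ∈ filter A? (nbs (pos v) (col v)) → z ∈ map coords (filter adjA? (allFin (order (G Ξ))))
    ⇐ i with ∈-filter⁻ A? {xs = nbs (pos v) (col v)} i
    ... | j , a with nbs-complete (pos< v) (col< v) j
    ...   | q<ℓ , d<2 , arc with coords-surjective q<ℓ d<2
    ...     | x , refl = ∈-map⁺ coords (∈-filter⁺ adjA? (∈-allFin x) (true∧true (edge arc) a))
      where
      edge : Arc (pos v) (col v) (pos x) (col x) ⊎ Arc (pos x) (col x) (pos v) (col v) → adj (G Ξ) v x ≡ true
      edge (inj₁ b) = ∨-trueˡ (Arc⇒edgeDir b)
      edge (inj₂ b) = ∨-trueʳ {edgeDir Ξ (pos v) (col v) (pos x) (col x)} (Arc⇒edgeDir b)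

-- The run determined by a labelling of the levels

b2n-injective : ∀ {a b} → b2n a ≡ b2n b → a ≡ b
b2n-injective {true}  {true}  _ = refl
b2n-injective {false} {false} _ = refl

separating : (h : Bool → ℕ) → h true ≢ h false → ∀ {a b} → h a ≡ h b ⇔ a ≡ b
separating h ne {true}  {true}  = mk⇔ (λ _ → refl) (λ _ → refl)
separating h ne {true}  {false} = mk⇔ (λ e → ⊥-elim (ne e)) λ ()
separating h ne {false} {true}  = mk⇔ (λ e → ⊥-elim (ne (sym e))) λ ()
separating h ne {false} {false} = mk⇔ (λ _ → refl) (λ _ → refl)

≡ᵇ-false : ∀ {m n} → (m ≡ᵇ n) ≡ false → m ≢ n
≡ᵇ-false {m} e refl = true≢false (≡ᵇ-refl m) e

⇔-rewrite : {a a′ b b′ : ℕ} {P : Set} → a ≡ a′ → b ≡ b′ → (a′ ≡ b′ ⇔ P) → (a ≡ b ⇔ P)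
⇔-rewrite refl refl h = h

⇔-rewrite₂ : {a a′ b b′ : ℕ} {x x′ y y′ : Bool} → a ≡ a′ → b ≡ b′ → x ≡ x′ → y ≡ y′ →
  (a′ ≡ b′ ⇔ x′ ≡ y′) → (a ≡ b ⇔ x ≡ y)
⇔-rewrite₂ refl refl refl refl h = h

both : {A B : Set} → A → B → A ⇔ B
both a b = mk⇔ (λ _ → b) (λ _ → a)

tally-map : {A B : Set} (p : B → Bool) (f : A → B) (xs : List A) → tally (p ∘ f) xs ≡ tally p (map f xs)
tally-map p f []       = refl
tally-map p f (x ∷ xs) = cong (b2n (p (f x)) +_) (tally-map p f xs)

map-when : {A B : Set} (f : A → B) (b : Bool) (x : A) → map f (when b x) ≡ when b (f x)
map-when f true  x = refl
map-when f false x = refl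

module Labelling {Ξ : List Letter} (lad : Ladder Ξ) (τ : ℕ → ℕ) where
  open Neighbourhoods lad

  near : ℕ → List ℕ
  near zero    = τ 1 ∷ τ r ∷ τ r ∷ []
  near (suc p) = τ p ∷ when (2 + p <ᵇ ℓ) (τ (2 + p)) ++ when (rung? (suc p)) (τ (suc p))
    ++ when (isX (at Ξ (suc p))) (τ 0)

  -- Outside level 0 both columns see the same levels. The two vertices of level 0 have spokes to
  -- different X levels, which `τ r ≡ τ r′` makes indistinguishable; hence `near` needs no column.
  map-nbs : τ r ≡ τ r′ → ∀ p c → map (τ ∘ proj₁) (nbs p c) ≡ near p
  map-nbs e zero zero    = refl
  map-nbs e zero (suc c) = cong (λ t → τ 1 ∷ t ∷ t ∷ []) (sym e)
  map-nbs e (suc p) c    = cong (τ p ∷_) (begin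
    map f (N ++ R ++ X′)        ≡⟨ map-++ f N (R ++ X′) ⟩
    map f N ++ map f (R ++ X′)  ≡⟨ cong₂ _++_ (map-when f (2 + p <ᵇ ℓ) _) (begin
      map f (R ++ X′)           ≡⟨ map-++ f R X′ ⟩
      map f R ++ map f X′       ≡⟨ cong₂ _++_ (map-when f (rung? (suc p)) _) (map-when f (isX (at Ξ (suc p))) _) ⟩
      _                         ∎) ⟩
    _                           ∎)
    where
    open ≡-Reasoning
    f = τ ∘ proj₁ {B = λ _ → ℕ}
    N = when (2 + p <ᵇ ℓ) (2 + p , c)
    R = when (rung? (suc p)) (suc p , 1 ∸ c)
    X′ = when (isX (at Ξ (suc p))) (0 , xsBefore Ξ (suc p))

  degreeIn-label : τ r ≡ τ r′ → ∀ (A : ℕ → Bool) v →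
    degreeIn (λ x → A (τ (pos x))) v ≡ tally A (near (pos v))
  degreeIn-label e A v = begin
    degreeIn (λ x → A (τ (pos x))) v               ≡⟨ degreeIn≡nbs (λ p _ → A (τ p)) v ⟩
    tally (λ z → A (τ (proj₁ z))) (nbs (pos v) (col v)) ≡⟨ tally-map A (τ ∘ proj₁) (nbs (pos v) (col v)) ⟩
    tally A (map (τ ∘ proj₁) (nbs (pos v) (col v))) ≡⟨ cong (tally A) (map-nbs e (pos v) (col v)) ⟩
    tally A (near (pos v))                         ∎
    where open ≡-Reasoning

-- τ is the labelling.  D is the part of the labels that has been split off at time t₀ (all of them if
-- t₀ = 0).  The number of neighbours with label in D, with a label i < m and with label m is
-- given by first, old and last; the latter also depends on whether the level is s.
record Schedule {Ξ : List Letter} (lad : Ladder Ξ) : Set where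
  open Neighbourhoods lad
  field
    τ        : ℕ → ℕ
    D        : ℕ → Bool
    m s d t₀ : ℕ
    τ-r      : τ r ≡ τ r′
    start    : Refined t₀ (λ v w → D (τ (pos v)) ≡ D (τ (pos w))) (λ v → D (τ (pos v)))
  open Labelling lad τ
  field
    old      : ℕ → ℕ → ℕ
    last     : ℕ → Bool → ℕ
    first    : Bool → Bool → ℕ
    near-D   : ∀ {p} → p < ℓ → tally D (near p) ≡ first (D (τ p)) (τ p ≡ᵇ 0)
    first-≢  : ∀ b → first b true ≢ first b false
    near-i   : ∀ {p i} → p < ℓ → i < m → tally (_≡ᵇ i) (near p) ≡ old (τ p) i
    -- Among the labels above `i`, only `i + 1` is adjacent to label `i`, and exactly once. So
    -- splitting off label `i` breaks off label `i + 1` next, and nothing else.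
    old-new  : ∀ {t i} → i < t → old t i ≡ b2n (t ≡ᵇ suc i)
    near-m   : ∀ {p} → p < ℓ → tally (_≡ᵇ m) (near p) ≡ last (τ p) (p ≡ᵇ s)
    last-≢   : last (τ s) true ≢ last (τ s) false
    unsettled : ∀ {i} → i ≤ m → ∃ λ p → ∃ λ q → p < ℓ × q < ℓ × τ p ≡ i × i < τ q × D (τ p) ≡ D (τ q)
    -- Once label `m` is split off, larger labels are told apart by `D` alone, so the classes are
    -- exactly the labels.
    settled  : ∀ {p q} → p < ℓ → q < ℓ → m < τ p → m < τ q → D (τ p) ≡ D (τ q) → τ p ≡ τ q
    s+d≡r    : s + d ≡ r
    -- The wave never visits the levels before `s`; each must be alone with its label once `s` has
    -- left.
    before-s : ∀ {p q} → p < s → q < ℓ → τ p ≡ τ q → p ≡ q ⊎ q ≡ s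
    mate-s   : ∃ λ q → q < ℓ × q ≢ s × τ s ≡ τ q
    -- A partner still ahead of the wave makes each of its splits proper.
    mate     : ∀ {p} → s < p → p ≤ r → ∃ λ q → q < ℓ × p < q × τ p ≡ τ q
    after-r  : ∀ {p q} → r < p → p < ℓ → r < q → q < ℓ → τ p ≡ τ q → p ≡ q
    -- Only a wave that starts at level 0 meets spokes leading to later levels; this condition
    -- prevents them from breaking a second class.
    X-label  : s ≡ 0 → ∀ {p q} → 0 < p → p < ℓ → 0 < q → q < ℓ → τ p ≡ τ q → isX (at Ξ p) ≡ isX (at Ξ q)
    -- The levels become the classes at time `2 + d + m + t₀`. With one new class per round, this
    -- time has to be `ℓ - 1`.
    total    : 2 + (d + suc (m + t₀)) ≡ ℓ

module Run {Ξ : List Letter} {lad : Ladder Ξ} (sch : Schedule lad) where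
  open Neighbourhoods lad
  open Schedule sch
  open Labelling lad τ

  lab : V → ℕ
  lab v = τ (pos v)

  vertex : ∀ {p c} → p < ℓ → c < 2 → V
  vertex p< c< = proj₁ (coords-surjective p< c<)

  pos-vertex : ∀ {p c} (p< : p < ℓ) (c< : c < 2) → pos (vertex p< c<) ≡ p
  pos-vertex p< c< = cong proj₁ (proj₂ (coords-surjective p< c<))

  col-vertex : ∀ {p c} (p< : p < ℓ) (c< : c < 2) → col (vertex p< c<) ≡ c
  col-vertex p< c< = cong proj₂ (proj₂ (coords-surjective p< c<))

  degree-label : ∀ (A : ℕ → Bool) v → degreeIn (λ x → A (lab x)) v ≡ tally A (near (pos v))
  degree-label = degreeIn-label τ-r

  -- Splitting off the labels in increasing order

  Levels : ℕ → V → V → Set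
  Levels i v w = D (lab v) ≡ D (lab w) × (lab v ≡ lab w ⊎ (i < lab v × i < lab w))

  levels-0 : Refined (suc t₀) (Levels 0) (λ v → lab v ≡ᵇ 0)
  levels-0 = refined-resp conv (λ _ → refl)
    (refined-step (λ v → lab v ≡ᵇ 0) start
      (λ v w e → ⇔-rewrite
        (trans (degree-label D v) (trans (near-D (pos< v)) (cong (λ b → first b (lab v ≡ᵇ 0)) e)))
        (trans (degree-label D w) (near-D (pos< w)))
        (separating (first (D (lab w))) (first-≢ (D (lab w)))))
      (λ v w a b → cong D (trans (≡ᵇ-true a) (sym (≡ᵇ-true b))))
      (let p , q , p< , q< , e , h , f = unsettled z≤n in
       vertex p< z<s , vertex q< z<s ,
       trans (cong (λ x → τ x ≡ᵇ 0) (pos-vertex p< z<s)) (cong (_≡ᵇ 0) e) ,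
       trans (cong (λ x → τ x ≡ᵇ 0) (pos-vertex q< z<s)) (≢⇒≡ᵇ (<⇒≢ h ∘ sym)) ,
       trans (cong (D ∘ τ) (pos-vertex p< z<s)) (trans f (cong (D ∘ τ) (sym (pos-vertex q< z<s))))))
    where
    conv : ∀ v w → (D (lab v) ≡ D (lab w) × (lab v ≡ᵇ 0) ≡ (lab w ≡ᵇ 0)) ⇔ Levels 0 v w
    conv v w = mk⇔ ⇒ λ { (e , inj₁ f) → e , cong (_≡ᵇ 0) f
                       ; (e , inj₂ (a , b)) → e , trans (≢⇒≡ᵇ (<⇒≢ a ∘ sym)) (sym (≢⇒≡ᵇ (<⇒≢ b ∘ sym))) }
      where
      ⇒ : D (lab v) ≡ D (lab w) × (lab v ≡ᵇ 0) ≡ (lab w ≡ᵇ 0) → Levels 0 v w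
      ⇒ (e , f) with lab v | lab w
      ... | zero  | zero  = e , inj₁ refl
      ... | suc _ | suc _ = e , inj₂ (z<s , z<s)

  levels : ∀ i → i ≤ m → Refined (suc (i + t₀)) (Levels i) (λ v → lab v ≡ᵇ i)
  levels zero    _   = levels-0
  levels (suc i) i<m = refined-resp conv (λ _ → refl)
    (refined-step (λ v → lab v ≡ᵇ suc i) (levels i (<⇒≤ i<m)) splits
      (λ v w a b → let e = trans (≡ᵇ-true a) (sym (≡ᵇ-true {lab w} b)) in cong D e , inj₁ e)
      (let p , q , p< , q< , e , h , f = unsettled i<m in
       let e′ = trans (cong τ (pos-vertex p< (z<s {1}))) e ; f′ = cong τ (pos-vertex q< (z<s {1})) in
       vertex p< z<s , vertex q< z<s ,
       trans (cong (_≡ᵇ suc i) e′) (≡ᵇ-refl i) ,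
       trans (cong (_≡ᵇ suc i) f′) (≢⇒≡ᵇ (<⇒≢ h ∘ sym)) ,
       trans (cong (D ∘ τ) (pos-vertex p< z<s)) (trans f (cong D (sym f′))) ,
       inj₂ (subst (i <_) (sym e′) (n<1+n i) , subst (i <_) (sym f′) (<-trans (n<1+n i) h))))
    where
    deg : ∀ v → degreeIn (λ v → lab v ≡ᵇ i) v ≡ old (lab v) i
    deg v = trans (degree-label (_≡ᵇ i) v) (near-i (pos< v) i<m)
    splits : ∀ v w → Levels i v w →
      degreeIn (λ v → lab v ≡ᵇ i) v ≡ degreeIn (λ v → lab v ≡ᵇ i) w ⇔ (lab v ≡ᵇ suc i) ≡ (lab w ≡ᵇ suc i)
    -- The count depends only on the label, so a class with a single label cannot break here.
    splits v w (_ , inj₁ e) = both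
      (trans (deg v) (trans (cong (λ t → old t i) e) (sym (deg w)))) (cong (_≡ᵇ suc i) e)
    splits v w (_ , inj₂ (a , b)) = ⇔-rewrite
      (trans (deg v) (old-new a)) (trans (deg w) (old-new b)) (mk⇔ b2n-injective (cong b2n))
    conv : ∀ v w → (Levels i v w × (lab v ≡ᵇ suc i) ≡ (lab w ≡ᵇ suc i)) ⇔ Levels (suc i) v w
    conv v w = mk⇔ ⇒ λ
      { (e , inj₁ f) → (e , inj₁ f) , cong (_≡ᵇ suc i) f
      ; (e , inj₂ (a , b)) → (e , inj₂ (<-trans (n<1+n i) a , <-trans (n<1+n i) b))
                           , trans (≢⇒≡ᵇ (<⇒≢ a ∘ sym)) (sym (≢⇒≡ᵇ (<⇒≢ b ∘ sym))) }
      where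
      ⇒ : Levels i v w × (lab v ≡ᵇ suc i) ≡ (lab w ≡ᵇ suc i) → Levels (suc i) v w
      ⇒ ((e , inj₁ f) , _) = e , inj₁ f
      ⇒ ((e , inj₂ (a , b)) , f) with lab w ≡ᵇ suc i in g
      ... | true  = e , inj₁ (trans (≡ᵇ-true f) (sym (≡ᵇ-true g)))
      ... | false = e , inj₂ (≤∧≢⇒< a (≡ᵇ-false f ∘ sym) , ≤∧≢⇒< b (≡ᵇ-false g ∘ sym))

  -- The wave that turns single levels into classes

  Upto : ℕ → V → V → Set
  Upto p v w = lab v ≡ lab w × (pos v ≡ pos w ⊎ (p < pos v × p < pos w))

  upto-s : Refined (suc (suc (m + t₀))) (Upto s) (λ v → pos v ≡ᵇ s)
  upto-s = refined-resp conv (λ _ → refl)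
    (refined-step (λ v → pos v ≡ᵇ s) (levels m ≤-refl)
      (λ v w h → splits v w (label v w h))
      (λ v w a b → let e = cong τ (trans (≡ᵇ-true a) (sym (≡ᵇ-true {pos w} b))) in cong D e , inj₁ e)
      (let q , q< , q≢s , e = mate-s in
       let e′ = trans (cong τ (pos-vertex s< (z<s {1}))) (trans e (cong τ (sym (pos-vertex q< (z<s {1}))))) in
       vertex s< z<s , vertex q< z<s ,
       trans (cong (_≡ᵇ s) (pos-vertex s< z<s)) (≡ᵇ-refl s) ,
       trans (cong (_≡ᵇ s) (pos-vertex q< z<s)) (≢⇒≡ᵇ q≢s) ,
       cong D e′ , inj₁ e′))
    where
    s< : s < ℓ
    s< = ≤-<-trans (subst (s ≤_) s+d≡r (m≤m+n s d)) r<ℓ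
    label : ∀ v w → Levels m v w → lab v ≡ lab w
    label v w (_ , inj₁ e)       = e
    label v w (e , inj₂ (a , b)) = settled (pos< v) (pos< w) a b e
    deg : ∀ v → degreeIn (λ v → lab v ≡ᵇ m) v ≡ last (lab v) (pos v ≡ᵇ s)
    deg v = trans (degree-label (_≡ᵇ m) v) (near-m (pos< v))
    splits : ∀ v w → lab v ≡ lab w →
      degreeIn (λ v → lab v ≡ᵇ m) v ≡ degreeIn (λ v → lab v ≡ᵇ m) w ⇔ (pos v ≡ᵇ s) ≡ (pos w ≡ᵇ s)
    splits v w e with pos v ≡ᵇ s in a | pos w ≡ᵇ s in b
    ... | true  | true  = both (trans (deg v) (trans (cong₂ last e (trans a (sym b))) (sym (deg w)))) refl
    ... | false | false = both (trans (deg v) (trans (cong₂ last e (trans a (sym b))) (sym (deg w)))) refl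
    ... | true  | false = ⇔-rewrite
      (trans (deg v) (cong₂ last (cong τ (≡ᵇ-true a)) a))
      (trans (deg w) (cong₂ last (trans (sym e) (cong τ (≡ᵇ-true a))) b))
      (separating (last (τ s)) last-≢)
    ... | false | true  = ⇔-rewrite
      (trans (deg v) (cong₂ last (trans e (cong τ (≡ᵇ-true {pos w} b))) a))
      (trans (deg w) (cong₂ last (cong τ (≡ᵇ-true {pos w} b)) b))
      (separating (last (τ s)) last-≢)
    conv : ∀ v w → (Levels m v w × (pos v ≡ᵇ s) ≡ (pos w ≡ᵇ s)) ⇔ Upto s v w
    conv v w = mk⇔ (λ (h , f) → label v w h , ⇒ (label v w h) f) λ
      { (e , inj₁ f) → (cong D e , inj₁ e) , cong (_≡ᵇ s) f
      ; (e , inj₂ (a , b)) → (cong D e , inj₁ e) , trans (≢⇒≡ᵇ (<⇒≢ a ∘ sym)) (sym (≢⇒≡ᵇ (<⇒≢ b ∘ sym))) }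
      where
      same-s : (pos v ≡ᵇ s) ≡ (pos w ≡ᵇ s) → pos v ≡ s → pos v ≡ pos w
      same-s f e = trans e (sym (≡ᵇ-true {pos w} (trans (sym f) (trans (cong (_≡ᵇ s) e) (≡ᵇ-refl s)))))
      same-s′ : (pos v ≡ᵇ s) ≡ (pos w ≡ᵇ s) → pos w ≡ s → pos v ≡ pos w
      same-s′ f e = trans (≡ᵇ-true {pos v} (trans f (trans (cong (_≡ᵇ s) e) (≡ᵇ-refl s)))) (sym e)
      ⇒ : lab v ≡ lab w → (pos v ≡ᵇ s) ≡ (pos w ≡ᵇ s) → pos v ≡ pos w ⊎ (s < pos v × s < pos w)
      ⇒ e f with <-cmp (pos v) s | <-cmp (pos w) s
      ... | tri≈ _ a _ | _          = inj₁ (same-s f a)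
      ... | _          | tri≈ _ a _ = inj₁ (same-s′ f a)
      ... | tri> _ _ a | tri> _ _ b = inj₂ (a , b)
      ... | tri< a _ _ | _ with before-s a (pos< w) e
      ...   | inj₁ g = inj₁ g
      ...   | inj₂ g = inj₁ (same-s′ f g)
      ⇒ e f | tri> _ _ a | tri< b _ _ with before-s b (pos< v) (sym e)
      ...   | inj₁ g = inj₁ (sym g)
      ...   | inj₂ g = inj₁ (same-s f g)

  onLevel : ℕ → ℕ → ℕ → Bool
  onLevel q x _ = x ≡ᵇ q

  -- Only at level 0 do the two columns see different levels.
  column-free : ∀ q p c c′ → degreeAt (onLevel q) (suc p) c ≡ degreeAt (onLevel q) (suc p) c′
  column-free q p c c′ = trans (tally-map (_≡ᵇ q) proj₁ (nbs (suc p) c))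
    (trans (cong (tally (_≡ᵇ q)) (trans (levels-of c) (sym (levels-of c′))))
      (sym (tally-map (_≡ᵇ q) proj₁ (nbs (suc p) c′))))
    where
    levels-of : ∀ c → map proj₁ (nbs (suc p) c) ≡ p ∷ when (2 + p <ᵇ ℓ) (2 + p)
      ++ when (rung? (suc p)) (suc p) ++ when (isX (at Ξ (suc p))) 0
    levels-of c with 2 + p <ᵇ ℓ | rung? (suc p) | isX (at Ξ (suc p))
    ... | true  | true  | true  = refl
    ... | true  | true  | false = refl
    ... | true  | false | true  = refl
    ... | true  | false | false = refl
    ... | false | true  | true  = refl
    ... | false | true  | false = refl
    ... | false | false | true  = refl
    ... | false | false | false = refl

  -- At level 0 the columns differ only in the spokes to `r` and to `r′`, and both levels lie beyond
  -- `q`. So the wave cannot separate columns before level `r` itself is counted.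
  column-free-< : ∀ {q} → q < r → ∀ p c c′ → degreeAt (onLevel q) p c ≡ degreeAt (onLevel q) p c′
  column-free-< {q} q<r zero c c′ =
    cong (λ b → b2n (1 ≡ᵇ q) + (b2n b + (b2n b + 0))) (trans (hub≢ c) (sym (hub≢ c′)))
    where
    hub≢ : ∀ c → (hub c ≡ᵇ q) ≡ false
    hub≢ zero    = ≢⇒≡ᵇ (<⇒≢ q<r ∘ sym)
    hub≢ (suc _) = ≢⇒≡ᵇ (<⇒≢ (<-trans q<r r<r′) ∘ sym)
  column-free-< {q} q<r (suc p) c c′ = column-free q p c c′

  -- Used both for whole levels and for halves of levels. From a level beyond `p`, the right rail
  -- and the rung end beyond `p`, where `A` vanishes; the left rail and a possible spoke into level
  -- 0 remain.
  degreeAt-above : ∀ {p} (A : ℕ → ℕ → Bool) → (∀ q c → q ≢ p → A q c ≡ false) → ∀ {q} c → p ≤ q →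
    degreeAt A (suc q) c ≡
    b2n (A q c) + b2n (isX (at Ξ (suc q)) ∧ A 0 (xsBefore Ξ (suc q)))
  degreeAt-above A off {q} c p≤q = cong (b2n (A q c) +_) (begin
    tally A′ (N ++ R ++ X′)                 ≡⟨ tally-++ A′ N (R ++ X′) ⟩
    tally A′ N + tally A′ (R ++ X′)
      ≡⟨ cong₂ _+_ (absent (2 + q <ᵇ ℓ) (2 + q) c (m≤n⇒m≤1+n (s≤s p≤q))) (tally-++ A′ R X′) ⟩
    tally A′ R + tally A′ X′
      ≡⟨ cong₂ _+_ (absent (rung? (suc q)) (suc q) (1 ∸ c) (s≤s p≤q)) (tally-when A′ (isX (at Ξ (suc q))) _) ⟩
    b2n (isX (at Ξ (suc q)) ∧ A 0 (xsBefore Ξ (suc q))) ∎)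
    where
    open ≡-Reasoning
    A′ = λ (z : ℕ × ℕ) → A (proj₁ z) (proj₂ z)
    N = when (2 + q <ᵇ ℓ) (2 + q , c)
    R = when (rung? (suc q)) (suc q , 1 ∸ c)
    X′ = when (isX (at Ξ (suc q))) (0 , xsBefore Ξ (suc q))
    absent : ∀ b x c → _ < x → tally A′ (when b (x , c)) ≡ 0
    absent b x c h rewrite tally-when A′ b (x , c) | off x c (<⇒≢ h ∘ sym) | 𝔹ₚ.∧-zeroʳ b = refl

  upto-suc : ∀ {t} p → s ≤ p → p < r → Refined t (Upto p) (λ v → pos v ≡ᵇ p) →
    Refined (suc t) (Upto (suc p)) (λ v → pos v ≡ᵇ suc p)
  upto-suc p s≤p p<r ref = refined-resp conv (λ _ → refl)
    (refined-step (λ v → pos v ≡ᵇ suc p) ref splits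
      (λ v w a b → let e = trans (≡ᵇ-true a) (sym (≡ᵇ-true {pos w} b)) in cong τ e , inj₁ e)
      (let q , q< , p<q , e = mate (s≤s s≤p) p<r ; p< = ≤-<-trans p<r r<ℓ
           f = pos-vertex p< (z<s {1}) ; g = pos-vertex q< (z<s {1}) in
       vertex p< z<s , vertex q< z<s ,
       trans (cong (_≡ᵇ suc p) f) (≡ᵇ-refl p) ,
       trans (cong (_≡ᵇ suc p) g) (≢⇒≡ᵇ (<⇒≢ p<q ∘ sym)) ,
       trans (cong τ f) (trans e (cong τ (sym g))) ,
       inj₂ (subst (p <_) (sym f) (n<1+n p) , subst (p <_) (sym g) (<-trans (n<1+n p) p<q))))
    where
    above : ∀ v → p < pos v →
      degreeIn (λ x → pos x ≡ᵇ p) v ≡ b2n (pos v ≡ᵇ suc p) + b2n (isX (at Ξ (pos v)) ∧ (0 ≡ᵇ p))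
    above v h with pos v | col v | degreeIn≡nbs (onLevel p) v | h
    ... | suc q | c | e | s≤s p≤q = trans e (degreeAt-above (onLevel p) (λ _ _ → ≢⇒≡ᵇ) c p≤q)
    -- A spoke ends in level 0 and counts only if `p` is 0. Then `s` is 0 too, and `X-label` makes
    -- the spoke terms equal.
    same-X : ∀ v w → lab v ≡ lab w → p < pos v → p < pos w →
      (isX (at Ξ (pos v)) ∧ (0 ≡ᵇ p)) ≡ (isX (at Ξ (pos w)) ∧ (0 ≡ᵇ p))
    same-X v w e a b with m≤n⇒m<n∨m≡n (z≤n {p})
    ... | inj₂ 0≡p = cong (_∧ (0 ≡ᵇ p)) (X-label (n≤0⇒n≡0 (subst (s ≤_) (sym 0≡p) s≤p))
      (subst (_< pos v) (sym 0≡p) a) (pos< v) (subst (_< pos w) (sym 0≡p) b) (pos< w) e)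
    ... | inj₁ 0<p rewrite ≢⇒≡ᵇ (<⇒≢ 0<p) =
      trans (𝔹ₚ.∧-zeroʳ (isX (at Ξ (pos v)))) (sym (𝔹ₚ.∧-zeroʳ (isX (at Ξ (pos w)))))
    splits : ∀ v w → Upto p v w →
      degreeIn (λ x → pos x ≡ᵇ p) v ≡ degreeIn (λ x → pos x ≡ᵇ p) w ⇔ (pos v ≡ᵇ suc p) ≡ (pos w ≡ᵇ suc p)
    splits v w (_ , inj₁ e) = both
      (trans (degreeIn≡nbs (onLevel p) v)
        (trans (trans (column-free-< p<r (pos v) (col v) (col w)) (cong (λ q → degreeAt (onLevel p) q (col w)) e))
          (sym (degreeIn≡nbs (onLevel p) w))))
      (cong (_≡ᵇ suc p) e)
    splits v w (f , inj₂ (a , b)) = ⇔-rewrite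
      (above v a) (trans (above w b) (cong (λ x → b2n (pos w ≡ᵇ suc p) + b2n x) (sym (same-X v w f a b))))
      (mk⇔ (b2n-injective ∘ +-cancelʳ-≡ (b2n (isX (at Ξ (pos v)) ∧ (0 ≡ᵇ p))) _ _)
           (cong (λ x → b2n x + b2n (isX (at Ξ (pos v)) ∧ (0 ≡ᵇ p)))))
    conv : ∀ v w → (Upto p v w × (pos v ≡ᵇ suc p) ≡ (pos w ≡ᵇ suc p)) ⇔ Upto (suc p) v w
    conv v w = mk⇔ ⇒ λ
      { (e , inj₁ f) → (e , inj₁ f) , cong (_≡ᵇ suc p) f
      ; (e , inj₂ (a , b)) → (e , inj₂ (<-trans (n<1+n p) a , <-trans (n<1+n p) b))
                           , trans (≢⇒≡ᵇ (<⇒≢ a ∘ sym)) (sym (≢⇒≡ᵇ (<⇒≢ b ∘ sym))) }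
      where
      ⇒ : Upto p v w × (pos v ≡ᵇ suc p) ≡ (pos w ≡ᵇ suc p) → Upto (suc p) v w
      ⇒ ((e , inj₁ f) , _) = e , inj₁ f
      ⇒ ((e , inj₂ (a , b)) , f) with pos w ≡ᵇ suc p in g
      ... | true  = e , inj₁ (trans (≡ᵇ-true f) (sym (≡ᵇ-true g)))
      ... | false = e , inj₂ (≤∧≢⇒< a (≡ᵇ-false f ∘ sym) , ≤∧≢⇒< b (≡ᵇ-false g ∘ sym))

  upto : ∀ j → j ≤ d → Refined (suc (suc (j + (m + t₀)))) (Upto (s + j)) (λ v → pos v ≡ᵇ s + j)
  upto zero    _   = subst (λ p → Refined (suc (suc (m + t₀))) (Upto p) (λ v → pos v ≡ᵇ p)) (sym (+-identityʳ s)) upto-s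
  upto (suc j) j<d = subst (λ p → Refined (suc (suc (suc j + (m + t₀)))) (Upto p) (λ v → pos v ≡ᵇ p)) (sym (+-suc s j))
    (upto-suc (s + j) (m≤m+n s j) (subst (s + j <_) s+d≡r (+-monoʳ-< s j<d)) (upto j (<⇒≤ j<d)))

  -- Splitting the levels into vertices

  half : ℕ → ℕ → ℕ → Bool
  half p x y = (x ≡ᵇ p) ∧ (y ≡ᵇ 0)

  Halved : ℕ → V → V → Set
  Halved p v w = pos v ≡ pos w × (col v ≡ col w ⊎ p < pos v)

  col-≡ : ∀ v w → (col v ≡ᵇ 0) ≡ (col w ≡ᵇ 0) → col v ≡ col w
  col-≡ v w e with col v | col w | col< v | col< w
  ... | zero        | zero        | _ | _ = refl
  ... | suc zero    | suc zero    | _ | _ = refl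
  ... | suc (suc _) | _           | s≤s (s≤s ()) | _
  ... | _           | suc (suc _) | _ | s≤s (s≤s ())

  halved-conv : ∀ p v w → pos v ≡ pos w → p ≡ pos v → lift (half p) v ≡ lift (half p) w → col v ≡ col w
  halved-conv p v w e refl f = col-≡ v w (begin
    (col v ≡ᵇ 0)                   ≡⟨ cong (_∧ (col v ≡ᵇ 0)) (sym (≡ᵇ-refl (pos v))) ⟩
    lift (half p) v                ≡⟨ f ⟩
    lift (half p) w                ≡⟨ cong (λ b → b ∧ (col w ≡ᵇ 0)) (trans (cong (_≡ᵇ pos v) (sym e)) (≡ᵇ-refl (pos v))) ⟩
    (col w ≡ᵇ 0)                   ∎)
    where open ≡-Reasoning

  half-off : ∀ p q c → q ≢ p → half p q c ≡ false
  half-off p q c ne = cong (_∧ (c ≡ᵇ 0)) (≢⇒≡ᵇ ne)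

  half-within : ∀ p v w → lift (half p) v ≡ true → lift (half p) w ≡ true → pos v ≡ pos w × col v ≡ col w
  half-within p v w a b = let a₁ , a₂ = ∧≡true a ; b₁ , b₂ = ∧≡true b in
    trans (≡ᵇ-true a₁) (sym (≡ᵇ-true {pos w} b₁)) , trans (≡ᵇ-true a₂) (sym (≡ᵇ-true {col w} b₂))

  half-witness : ∀ p → p < ℓ → ∃ λ v → ∃ λ w →
    lift (half p) v ≡ true × lift (half p) w ≡ false × pos v ≡ p × pos w ≡ p
  half-witness p p< =
    vertex p< z<s , vertex p< (s<s z<s) ,
    true∧true (trans (cong (_≡ᵇ p) (pos-vertex p< z<s)) (≡ᵇ-refl p)) (cong (_≡ᵇ 0) (col-vertex p< z<s)) ,
    trans (cong (λ b → (pos (vertex p< (s<s z<s)) ≡ᵇ p) ∧ (b ≡ᵇ 0)) (col-vertex p< (s<s z<s))) (𝔹ₚ.∧-zeroʳ _) ,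
    pos-vertex p< z<s , pos-vertex p< (s<s z<s)

  halved-0 : Refined (suc (suc (suc (d + (m + t₀))))) (Halved 0) (lift (half 0))
  halved-0 = refined-resp conv (λ _ → refl)
    (refined-step (lift (half 0)) upto-r
      (λ v w h → splits v w (level v w h))
      (λ v w a b → let e , _ = half-within 0 v w a b in cong τ e , inj₁ e)
      (let v , w , a , b , e , f = half-witness 0 (<-trans z<s 1<ℓ) ; g = trans e (sym f) in
       v , w , a , b , cong τ g , inj₁ g))
    where
    upto-r : Refined (suc (suc (d + (m + t₀)))) (Upto r) (λ v → pos v ≡ᵇ r)
    upto-r = subst (λ p → Refined _ (Upto p) (λ v → pos v ≡ᵇ p)) s+d≡r (upto d ≤-refl)
    level : ∀ v w → Upto r v w → pos v ≡ pos w
    level v w (_ , inj₁ e)       = e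
    level v w (f , inj₂ (a , b)) = after-r a (pos< v) b (pos< w) f
    -- Both spokes of column 0 end in level `r`, both of column 1 in `r′`, and `1<r` keeps the rail
    -- to level 1 out of the count. This is the first count that depends on the column.
    hub-tally : ∀ {c} → c < 2 → degreeAt (onLevel r) 0 c ≡ (if c ≡ᵇ 0 then 2 else 0)
    hub-tally c<2 with <2⇒ c<2
    ... | inj₁ refl rewrite ≢⇒≡ᵇ (<⇒≢ 1<r) | ≡ᵇ-refl r = refl
    ... | inj₂ refl rewrite ≢⇒≡ᵇ (<⇒≢ 1<r) | ≢⇒≡ᵇ (<⇒≢ r<r′ ∘ sym) = refl
    at-hub : ∀ v → pos v ≡ 0 → degreeIn (λ x → pos x ≡ᵇ r) v ≡ (if col v ≡ᵇ 0 then 2 else 0)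
    at-hub v e = trans (degreeIn≡nbs (onLevel r) v)
      (trans (cong (λ p → degreeAt (onLevel r) p (col v)) e) (hub-tally (col< v)))
    splits : ∀ v w → pos v ≡ pos w →
      degreeIn (λ x → pos x ≡ᵇ r) v ≡ degreeIn (λ x → pos x ≡ᵇ r) w ⇔ lift (half 0) v ≡ lift (half 0) w
    splits v w e = at-level (pos v) refl (sym e)
      where
      at-level : ∀ p → pos v ≡ p → pos w ≡ p →
        degreeIn (λ x → pos x ≡ᵇ r) v ≡ degreeIn (λ x → pos x ≡ᵇ r) w ⇔ lift (half 0) v ≡ lift (half 0) w
      at-level zero f g = ⇔-rewrite₂ (at-hub v f) (at-hub w g)
        (cong (λ x → half 0 x (col v)) f) (cong (λ x → half 0 x (col w)) g)
        (separating (λ b → if b then 2 else 0) λ ())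
      at-level (suc p) f g = both
        (trans (degreeIn≡nbs (onLevel r) v)
          (trans (cong (λ p → degreeAt (onLevel r) p (col v)) f)
            (trans (column-free r p (col v) (col w))
              (trans (cong (λ p → degreeAt (onLevel r) p (col w)) (sym g))
                (sym (degreeIn≡nbs (onLevel r) w))))))
          (trans (cong (λ p → half 0 p (col v)) f) (cong (λ p → half 0 p (col w)) (sym g)))
    conv : ∀ v w → (Upto r v w × lift (half 0) v ≡ lift (half 0) w) ⇔ Halved 0 v w
    conv v w = mk⇔ (λ (h , f) → level v w h , ⇒ (level v w h) f) λ
      { (e , inj₁ f) → (cong τ e , inj₁ e) , cong₂ (half 0) e f
      ; (e , inj₂ h) → (cong τ e , inj₁ e) , trans (half-off 0 (pos v) (col v) (<⇒≢ h ∘ sym))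
                         (sym (half-off 0 (pos w) (col w) (<⇒≢ (subst (0 <_) e h) ∘ sym))) }
      where
      ⇒ : pos v ≡ pos w → lift (half 0) v ≡ lift (half 0) w → col v ≡ col w ⊎ 0 < pos v
      ⇒ e f with m≤n⇒m<n∨m≡n (z≤n {pos v})
      ... | inj₁ h = inj₂ h
      ... | inj₂ h = inj₁ (halved-conv 0 v w e h f)

  halved-suc : ∀ {t} p → suc p < ℓ → Refined t (Halved p) (lift (half p)) →
    Refined (suc t) (Halved (suc p)) (lift (half (suc p)))
  halved-suc p p< ref = refined-resp conv (λ _ → refl)
    (refined-step (lift (half (suc p))) ref splits
      (λ v w a b → let e , f = half-within (suc p) v w a b in e , inj₁ f)
      (let v , w , a , b , e , f = half-witness (suc p) p< in
       v , w , a , b , trans e (sym f) , inj₂ (subst (p <_) (sym e) (n<1+n p))))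
    where
    above : ∀ v q → pos v ≡ suc q → p ≤ q → degreeIn (lift (half p)) v ≡
      b2n (half p q (col v)) + b2n (isX (at Ξ (suc q)) ∧ half p 0 (xsBefore Ξ (suc q)))
    above v q e h = trans (degreeIn≡nbs (half p) v)
      (trans (cong (λ x → degreeAt (half p) x (col v)) e) (degreeAt-above (half p) (half-off p) (col v) h))
    splits : ∀ v w → Halved p v w →
      degreeIn (lift (half p)) v ≡ degreeIn (lift (half p)) w ⇔ lift (half (suc p)) v ≡ lift (half (suc p)) w
    splits v w (e , inj₁ f) = both
      (trans (degreeIn≡nbs (half p) v)
        (trans (cong₂ (λ x c → degreeAt (half p) x c) e f) (sym (degreeIn≡nbs (half p) w))))
      (cong₂ (half (suc p)) e f)
    splits v w (e , inj₂ h) = at-level (pos v) refl (sym e) h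
      where
      at-level : ∀ q → pos v ≡ q → pos w ≡ q → p < q →
        degreeIn (lift (half p)) v ≡ degreeIn (lift (half p)) w ⇔ lift (half (suc p)) v ≡ lift (half (suc p)) w
      -- The spoke term depends on the level only and cancels. What is left, `half p q`, is
      -- `half (suc p) (suc q)` by computation: the rails carry the split one level further.
      at-level (suc q) f g (s≤s h) = ⇔-rewrite₂ (above v q f h) (above w q g h)
        (cong (λ x → half (suc p) x (col v)) f) (cong (λ x → half (suc p) x (col w)) g)
        (mk⇔ (b2n-injective ∘ +-cancelʳ-≡ k _ _) (cong (λ x → b2n x + k)))
        where k = b2n (isX (at Ξ (suc q)) ∧ half p 0 (xsBefore Ξ (suc q)))
    conv : ∀ v w → (Halved p v w × lift (half (suc p)) v ≡ lift (half (suc p)) w) ⇔ Halved (suc p) v w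
    conv v w = mk⇔ ⇒ λ
      { (e , inj₁ f) → (e , inj₁ f) , cong₂ (half (suc p)) e f
      ; (e , inj₂ h) → (e , inj₂ (<-trans (n<1+n p) h)) ,
          trans (half-off (suc p) (pos v) (col v) (<⇒≢ h ∘ sym))
            (sym (half-off (suc p) (pos w) (col w) (<⇒≢ (subst (suc p <_) e h) ∘ sym))) }
      where
      ⇒ : Halved p v w × lift (half (suc p)) v ≡ lift (half (suc p)) w → Halved (suc p) v w
      ⇒ ((e , inj₁ f) , _) = e , inj₁ f
      ⇒ ((e , inj₂ h) , f) with m≤n⇒m<n∨m≡n h
      ... | inj₁ k = e , inj₂ k
      ... | inj₂ k = e , inj₁ (halved-conv (suc p) v w e k f)

  halved : ∀ p → p < ℓ → Refined (p + suc (suc (suc (d + (m + t₀))))) (Halved p) (lift (half p))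
  halved zero    _  = halved-0
  halved (suc p) p< = halved-suc p p< (halved p (<-trans (n<1+n p) p<))

  long-refinement : LongRefinement (G Ξ)
  long-refinement = subst (WL1≡ (G Ξ)) time (refined-stable (halved p p<) λ v w (e , h) →
    trans (degreeIn≡nbs (half p) v)
      (trans (cong₂ (λ x c → degreeAt (half p) x c) e (discrete v w h)) (sym (degreeIn≡nbs (half p) w))))
    where
    -- By `total` this is the last level, so `Halved p` is equality of vertices. The time reached is
    -- `p + suc p`, which is twice `ℓ` minus 1.
    p = suc (d + suc (m + t₀))
    p< : p < ℓ
    p< = ≤-reflexive total
    discrete : ∀ v w → col v ≡ col w ⊎ p < pos v → col v ≡ col w
    discrete v w (inj₁ e) = e
    discrete v w (inj₂ h) = ⊥-elim (<⇒≱ (pos< v) (subst (_≤ pos v) total h))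
    time : p + suc (suc (suc (d + (m + t₀)))) ≡ ℓ * 2 ∸ 1
    time = begin
      p + suc (suc (suc (d + (m + t₀)))) ≡⟨ cong (λ x → p + suc (suc x)) (sym (+-suc d (m + t₀))) ⟩
      p + suc p                          ≡⟨ +-suc p p ⟩
      suc (p + p)                        ≡⟨ cong (λ x → suc (p + x)) (sym (+-identityʳ p)) ⟩
      suc (2 * p)                        ≡⟨ cong suc (*-comm 2 p) ⟩
      suc p * 2 ∸ 1                      ≡⟨ cong (λ x → x * 2 ∸ 1) total ⟩
      ℓ * 2 ∸ 1                          ∎
      where open ≡-Reasoning

-- Labelled words

nth : List ℕ → ℕ → ℕ
nth []       _       = 0
nth (t ∷ ts) zero    = t
nth (t ∷ ts) (suc k) = nth ts k

nth-++ʳ : ∀ xs {ys} k → nth (xs ++ ys) (length xs + k) ≡ nth ys k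
nth-++ʳ []       k = refl
nth-++ʳ (x ∷ xs) k = nth-++ʳ xs k

nth-downFrom< : ∀ b {k} → k < b → nth (downFrom b) k < b
nth-downFrom< (suc b) {zero}  _       = n<1+n b
nth-downFrom< (suc b) {suc k} (s≤s h) = m<n⇒m<1+n (nth-downFrom< b h)

nth-downFrom-injective : ∀ b {j k} → j < b → k < b → nth (downFrom b) j ≡ nth (downFrom b) k → j ≡ k
nth-downFrom-injective (suc b) {zero}  {zero}  _ _ _ = refl
nth-downFrom-injective (suc b) {zero}  {suc k} _ (s≤s h) e = ⊥-elim (<⇒≢ (nth-downFrom< b h) (sym e))
nth-downFrom-injective (suc b) {suc j} {zero}  (s≤s h) _ e = ⊥-elim (<⇒≢ (nth-downFrom< b h) e)
nth-downFrom-injective (suc b) {suc j} {suc k} (s≤s h) (s≤s h′) e = cong suc (nth-downFrom-injective b h h′ e)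

nth-downFrom-surjective : ∀ b {t} → t < b → ∃ λ k → k < b × nth (downFrom b) k ≡ t
nth-downFrom-surjective (suc b) {t} (s≤s h) with m≤n⇒m<n∨m≡n h
... | inj₂ refl = 0 , z<s , refl
... | inj₁ t<b  = let k , k<b , e = nth-downFrom-surjective b t<b in suc k , s<s k<b , e

-- Positions of the letters X in a word

NoX : List Letter → Set
NoX = All (λ a → isX a ≡ false)

at-++ʳ : ∀ u {w} k → at (u ++ w) (length u + k) ≡ at w k
at-++ʳ []      k = refl
at-++ʳ (a ∷ u) k = at-++ʳ u k

xsBefore-∷ : ∀ a as k → isX a ≡ false → xsBefore (a ∷ as) (suc k) ≡ xsBefore as k
xsBefore-∷ S as k _ = refl
xsBefore-∷ O as k _ = refl
xsBefore-∷ I as k _ = refl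

xsBefore-++ʳ : ∀ {u w} → NoX u → ∀ k → xsBefore (u ++ w) (length u + k) ≡ xsBefore w k
xsBefore-++ʳ [] k = refl
xsBefore-++ʳ {a ∷ u} {w} (h ∷ hs) k = trans (xsBefore-∷ a (u ++ w) (length u + k) h) (xsBefore-++ʳ hs k)

isX-++ : ∀ {u w} → NoX u → ∀ q → isX (at (u ++ w) q) ≡ true → ∃ λ k → q ≡ length u + k
isX-++ []                q       _ = q , refl
isX-++ (h ∷ hs) zero    x = true≢false x h
isX-++ (h ∷ hs) (suc q) x = let k , e = isX-++ hs q x in k , cong suc e

NoX⇒at : ∀ {u} → NoX u → ∀ q → isX (at u q) ≡ false
NoX⇒at []       _       = refl
NoX⇒at (h ∷ hs) zero    = h
NoX⇒at (h ∷ hs) (suc q) = NoX⇒at hs q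

ladder : ∀ {u v w} → 0 < length u → NoX u → NoX v → NoX w → Ladder (S ∷ u ++ X ∷ v ++ X ∷ w)
ladder {u} {v} {w} u>0 nu nv nw = record
  { r       = r
  ; r′      = r′
  ; 1<r     = s<s u>0
  ; r<r′    = s<s (m<m+n (length u) z<s)
  ; r′<ℓ    = s<s r′<
  ; at-0    = refl
  ; isX-r   = trans (cong (λ q → isX (at Ξ q)) (sym (+-identityʳ r))) (cong isX (at-++ʳ (S ∷ u) 0))
  ; xs-r    = trans (cong (xsBefore Ξ) (sym (+-identityʳ r))) (xsBefore-++ʳ nSu 0)
  ; isX-r′  = trans (cong isX (at-++ʳ (S ∷ u) (suc (length v)))) (isX-mid)
  ; xs-r′   = trans (xsBefore-++ʳ nSu (suc (length v))) (cong suc xs-mid)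
  ; isX-inv = inv
  }
  where
  Ξ = S ∷ u ++ X ∷ v ++ X ∷ w
  r = suc (length u)
  r′ = suc (length u + suc (length v))
  nSu : NoX (S ∷ u)
  nSu = refl ∷ nu
  r′< : length u + suc (length v) < length (u ++ X ∷ v ++ X ∷ w)
  r′< rewrite length-++ u {X ∷ v ++ X ∷ w} | length-++ v {X ∷ w} =
    +-monoʳ-< (length u) (s<s (m<m+n (length v) z<s))
  isX-mid : isX (at (v ++ X ∷ w) (length v)) ≡ true
  isX-mid = trans (cong (λ q → isX (at (v ++ X ∷ w) q)) (sym (+-identityʳ (length v)))) (cong isX (at-++ʳ v 0))
  xs-mid : xsBefore (v ++ X ∷ w) (length v) ≡ 0
  xs-mid = trans (cong (xsBefore (v ++ X ∷ w)) (sym (+-identityʳ (length v)))) (xsBefore-++ʳ nv 0)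
  inv : ∀ q → isX (at Ξ q) ≡ true → (q ≡ r × xsBefore Ξ q ≡ 0) ⊎ (q ≡ r′ × xsBefore Ξ q ≡ 1)
  inv q x with isX-++ nSu q x
  ... | zero , refl = inj₁ (+-identityʳ r , xsBefore-++ʳ nSu 0)
  ... | suc k , refl with isX-++ nv k (subst (λ a → isX a ≡ true) (at-++ʳ (S ∷ u) (suc k)) x)
  ...   | zero , refl = inj₂ (cong (λ j → suc (length u + suc j)) (+-identityʳ (length v)) ,
            trans (xsBefore-++ʳ nSu (suc (length v + 0))) (cong suc (xsBefore-++ʳ nv 0)))
  ...   | suc j , refl = true≢false
            (subst (λ a → isX a ≡ true)
              (trans (at-++ʳ (S ∷ u) (suc (length v + suc j))) (at-++ʳ v (suc j))) x)
            (NoX⇒at nw j)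

Word : Set
Word = List (Letter × ℕ)

letters : Word → List Letter
letters = map proj₁

labels : Word → List ℕ
labels = map proj₂

nextLabel : Word → List ℕ
nextLabel []            = []
nextLabel ((_ , t) ∷ _) = t ∷ []

-- Q holds at every letter of a word, with its position, its label and the labels of the neighbouring levels.
-- The arguments are the label z of level 0 and the position and label preceding the word.
Along : (ℕ → ℕ → List ℕ → Set) → ℕ → ℕ → ℕ → Word → Set
Along Q z p t₋ []             = ⊤
Along Q z p t₋ ((a , t) ∷ ws) =
  Q (suc p) t (t₋ ∷ nextLabel ws ++ when (isOne a ∨ null ws) t ++ when (isX a) z) × Along Q z (suc p) t ws

-- This is `near` at level `k + 1`, read off the word behind the letter S. Prefixing `t₋` to the
-- labels makes index `k` yield the label on the left.
labelsNear : ℕ → ℕ → List Letter → List ℕ → ℕ → List ℕ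
labelsNear z t₋ as ts k = nth (t₋ ∷ ts) k ∷ when (suc k <ᵇ length as) (nth ts (suc k))
  ++ when (isOne (at as k) ∨ (suc k ≡ᵇ length as)) (nth ts k) ++ when (isX (at as k)) z

along-nth : ∀ {Q z} p t₋ ws → Along Q z p t₋ ws → ∀ k → k < length (letters ws) →
  Q (suc (p + k)) (nth (labels ws) k) (labelsNear z t₋ (letters ws) (labels ws) k)
along-nth {Q} {z} p t₋ ws@((a , t) ∷ []) (q , _) zero _ =
  subst (λ p → Q (suc p) t (labelsNear z t₋ (letters ws) (labels ws) 0)) (sym (+-identityʳ p)) q
along-nth {Q} {z} p t₋ ws@((a , t) ∷ _ ∷ _) (q , _) zero _ =
  subst (λ p → Q (suc p) t (labelsNear z t₋ (letters ws) (labels ws) 0)) (sym (+-identityʳ p)) q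
along-nth {Q} {z} p t₋ ((a , t) ∷ ws) (_ , qs) (suc k) (s≤s h) =
  subst (λ p → Q (suc p) (nth (labels ws) k) (labelsNear z t (letters ws) (labels ws) k)) (sym (+-suc p k))
    (along-nth {Q} (suc p) t ws qs k h)

All-nth : ∀ {P : Letter → ℕ → Set} {ws} → All (λ (a , t) → P a t) ws → ∀ k → k < length (letters ws) →
  P (at (letters ws) k) (nth (labels ws) k)
All-nth (h ∷ hs) zero    _       = h
All-nth (h ∷ hs) (suc k) (s≤s l) = All-nth hs k l

All-drop-nth : ∀ {P : ℕ → Set} s {ws} → All (λ (_ , t) → P t) (drop s ws) → ∀ {k} → s ≤ k → k < length (letters ws) →
  P (nth (labels ws) k)
All-drop-nth {P} zero h {k} _ l = All-nth {P = λ _ → P} h k l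
All-drop-nth (suc s) {_ ∷ ws} h {suc k} (s≤s e) (s≤s l) = All-drop-nth s h e l

-- Both letters X receive the same label `x`, so that `τ r ≡ τ r′` holds by construction.
record Layout : Set where
  field
    front inner outer : Word
    z x               : ℕ
    front>0           : 0 < length (letters front)
    NoX-front         : NoX (letters front)
    NoX-inner         : NoX (letters inner)
    NoX-outer         : NoX (letters outer)

  word : Word
  word = front ++ (X , x) ∷ inner ++ (X , x) ∷ outer

  Ξ : List Letter
  Ξ = S ∷ letters front ++ X ∷ letters inner ++ X ∷ letters outer

  tail : List ℕ
  tail = labels front ++ x ∷ labels inner ++ x ∷ labels outer

  letters-word : letters word ≡ letters front ++ X ∷ letters inner ++ X ∷ letters outer
  letters-word = trans (map-++ proj₁ front _) (cong (λ w → letters front ++ X ∷ w) (map-++ proj₁ inner _))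

  labels-word : labels word ≡ tail
  labels-word = trans (map-++ proj₂ front _) (cong (λ w → labels front ++ x ∷ w) (map-++ proj₂ inner _))

  lad : Ladder Ξ
  lad = ladder front>0 NoX-front NoX-inner NoX-outer

  τ : ℕ → ℕ
  τ = nth (z ∷ tail)

  open Neighbourhoods lad
  open Labelling lad τ

  τ-X : τ r ≡ x × τ r′ ≡ x
  τ-X rewrite length-map proj₁ front | length-map proj₁ inner
            | sym (length-map proj₂ front) | sym (length-map proj₂ inner) =
    trans (cong (nth tail) (sym (+-identityʳ (length (labels front))))) (nth-++ʳ (labels front) 0) ,
    trans (nth-++ʳ (labels front) (suc (length (labels inner))))
      (trans (cong (nth (labels inner ++ x ∷ labels outer)) (sym (+-identityʳ (length (labels inner)))))
        (nth-++ʳ (labels inner) 0))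

  lookup-near : ∀ {Q} → Along Q z 0 z word → Q 0 z (nth (labels word) 0 ∷ x ∷ x ∷ []) →
    ∀ {p} → p < ℓ → Q p (τ p) (near p)
  lookup-near {Q} h h₀ {zero} _ = subst (λ a → Q 0 z a)
    (cong₂ _∷_ (cong (λ ts → nth ts 0) labels-word)
      (cong (λ a → a ∷ a ∷ []) (sym (proj₁ τ-X)))) h₀
  lookup-near {Q} h h₀ {suc k} (s≤s l) =
    subst₂ (λ as ts → Q (suc k) (nth ts k) (labelsNear z z as ts k)) letters-word labels-word
      (along-nth {Q} 0 z word h k (subst (λ as → k < length as) (sym letters-word) l))

  lookup-All : ∀ {P : Letter → ℕ → Set} → All (λ (a , t) → P a t) word → ∀ {p} → 0 < p → p < ℓ →
    P (at Ξ p) (τ p)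
  lookup-All {P} h {suc k} _ (s≤s l) = subst₂ (λ as ts → P (at as k) (nth ts k)) letters-word labels-word
    (All-nth h k (subst (λ as → k < length as) (sym letters-word) l))

  lookup-drop : ∀ {P : ℕ → Set} s → All (λ (_ , t) → P t) (drop s word) → ∀ {p} → s < p → p < ℓ → P (τ p)
  lookup-drop {P} s h {suc k} (s≤s e) (s≤s l) = subst (λ ts → P (nth ts k)) labels-word
    (All-drop-nth s h e (subst (λ as → k < length as) (sym letters-word) l))

  -- Behind the first X every label below `b` occurs exactly once, in decreasing order. These levels
  -- are a full copy of the path onto which the others are folded: `find` supplies partners for the
  -- wave, and `back-injective` shows that the wave may stop at `r`.
  module _ {b} (back : labels inner ++ x ∷ labels outer ≡ downFrom b) where

    length-back : length (letters inner ++ X ∷ letters outer) ≡ b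
    length-back = begin
      length (letters inner ++ X ∷ letters outer) ≡⟨ length-++ (letters inner) ⟩
      length (letters inner) + suc (length (letters outer))
        ≡⟨ cong₂ (λ i o → i + suc o) (trans (length-map proj₁ inner) (sym (length-map proj₂ inner)))
                                     (trans (length-map proj₁ outer) (sym (length-map proj₂ outer))) ⟩
      length (labels inner) + suc (length (labels outer)) ≡⟨ sym (length-++ (labels inner)) ⟩
      length (labels inner ++ x ∷ labels outer)   ≡⟨ cong length back ⟩
      length (downFrom b)                         ≡⟨ length-downFrom b ⟩
      b                                           ∎
      where open ≡-Reasoning

    ℓ≡r+b : ℓ ≡ suc (r + b)
    ℓ≡r+b = cong suc (begin
      length (letters front ++ X ∷ letters inner ++ X ∷ letters outer) ≡⟨ length-++ (letters front) ⟩
      length (letters front) + suc (length (letters inner ++ X ∷ letters outer))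
        ≡⟨ cong (λ j → length (letters front) + suc j) length-back ⟩
      length (letters front) + suc b ≡⟨ +-suc (length (letters front)) b ⟩
      r + b                          ∎)
      where open ≡-Reasoning

    τ-back : ∀ k → τ (suc r + k) ≡ nth (downFrom b) k
    τ-back k rewrite length-map proj₁ front | sym (length-map proj₂ front) = begin
      nth tail (suc (length (labels front) + k)) ≡⟨ cong (nth tail) (sym (+-suc (length (labels front)) k)) ⟩
      nth tail (length (labels front) + suc k)   ≡⟨ nth-++ʳ (labels front) (suc k) ⟩
      nth (labels inner ++ x ∷ labels outer) k   ≡⟨ cong (λ ts → nth ts k) back ⟩
      nth (downFrom b) k                         ∎
      where open ≡-Reasoning

    find : ∀ {t} → t < b → ∃ λ q → q < ℓ × r < q × τ q ≡ t
    find t<b = let k , k<b , e = nth-downFrom-surjective b t<b in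
      suc r + k , subst (suc r + k <_) (sym ℓ≡r+b) (s<s (+-monoʳ-< r k<b)) , s≤s (m≤m+n r k) , trans (τ-back k) e

    back-injective : ∀ {p q} → r < p → p < ℓ → r < q → q < ℓ → τ p ≡ τ q → p ≡ q
    back-injective {p} {q} r<p p<ℓ r<q q<ℓ e = begin
      p           ≡⟨ sym (m+[n∸m]≡n r<p) ⟩
      suc r + j   ≡⟨ cong (suc r +_) (nth-downFrom-injective b (bound r<p p<ℓ) (bound r<q q<ℓ) (begin
        nth (downFrom b) j ≡⟨ sym (τ-back j) ⟩
        τ (suc r + j)      ≡⟨ cong τ (m+[n∸m]≡n r<p) ⟩
        τ p                ≡⟨ e ⟩
        τ q                ≡⟨ cong τ (sym (m+[n∸m]≡n r<q)) ⟩
        τ (suc r + k)      ≡⟨ τ-back k ⟩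
        nth (downFrom b) k ∎)) ⟩
      suc r + k   ≡⟨ m+[n∸m]≡n r<q ⟩
      q           ∎
      where
      open ≡-Reasoning
      j = p ∸ suc r
      k = q ∸ suc r
      bound : ∀ {p} → r < p → p < ℓ → p ∸ suc r < b
      bound {p} r<p p<ℓ = +-cancelˡ-< (suc r) (p ∸ suc r) b
        (subst₂ _<_ (sym (m+[n∸m]≡n r<p)) ℓ≡r+b p<ℓ)

-- Arms labelled along a path

shift : ℕ → Word → Word
shift n = map (λ (a , o) → a , o + n)

-- In the arms, the levels have labels 0, …, n, and the letter of label t is 0 if P t and 1 otherwise.
record Pattern : Set where
  field
    n       : ℕ
    P D     : ℕ → Bool
    first   : Bool → Bool → ℕ
    P-0     : P 0 ≡ true
    -- Labels above `n` behave like their offsets, so the centre can be checked by computation.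
    -- Offset 0 is excluded: for `_≡ᵇ 0`, label 0 satisfies `P` but a positive `n` does not.
    P-shift : ∀ o → P (suc o + n) ≡ P (suc o)
    D-shift : ∀ o → D (o + n) ≡ D o
    D-inner : ∀ t → b2n (D (2 + t)) + (b2n (D t) + b2n (not (P (suc t)) ∧ D (suc t))) ≡ first (D (suc t)) false
    -- A level labelled 0 sees another 0: the end of the adjoining arm, or its own partner across
    -- the final rung.
    D-zero  : b2n (D 1) + (b2n (D 0) + 0) ≡ first (D 0) true
    first-≢ : ∀ b → first b true ≢ first b false

  arm : ℕ → Letter
  arm t = if P t then O else I

  downs : ℕ → Word
  downs zero    = []
  downs (suc t) = (arm t , t) ∷ downs t

  ups : ℕ → ℕ → Word
  ups t zero    = []
  ups t (suc c) = (arm t , t) ∷ ups (suc t) c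

  isX-arm : ∀ t → isX (arm t) ≡ false
  isX-arm t with P t
  ... | true  = refl
  ... | false = refl

  labels-downs : ∀ t → labels (downs t) ≡ downFrom t
  labels-downs zero    = refl
  labels-downs (suc t) = cong (t ∷_) (labels-downs t)

  All-downs : ∀ {Q : Letter × ℕ → Set} t → (∀ {j} → j < t → Q (arm j , j)) → All Q (downs t)
  All-downs zero    h = []
  All-downs (suc t) h = h (n<1+n t) ∷ All-downs t (h ∘ m<n⇒m<1+n)

  All-ups : ∀ {Q : Letter × ℕ → Set} t c → (∀ {j} → j < t + c → Q (arm j , j)) → All Q (ups t c)
  All-ups t zero    h = []
  All-ups t (suc c) h = h (m<m+n t z<s) ∷ All-ups (suc t) c (λ {j} l → h (subst (j <_) (sym (+-suc t c)) l))

-- Neighbour counts forced by the labels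

module Rules (pat : Pattern) (s : ℕ) (top : ℕ → Bool → ℕ) where
  open Pattern pat

  -- The formula for a path with rungs is kept for the centre too. For `i` at most `n` it stays
  -- correct there, since among the labels above `n` only `n + 1` is adjacent to `n`, and exactly
  -- once.
  old : ℕ → ℕ → ℕ
  old zero    i = b2n (1 ≡ᵇ i) + (b2n (0 ≡ᵇ i) + 0)
  old (suc t) i = b2n (2 + t ≡ᵇ i) + (b2n (t ≡ᵇ i) + b2n (not (P (suc t)) ∧ (suc t ≡ᵇ i)))

  last : ℕ → Bool → ℕ
  last t b = b2n (t ≡ᵇ n) + (if t ≤ᵇ n then 0 else top (t ∸ n) b)

  -- Everything the run asks about one level, in terms of the list of neighbouring labels: `byD`,
  -- `byOld` and `byTop` yield the three counts of a `Schedule`, and `arity` serves the runs whose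
  -- first round compares degrees.
  record Good (p t : ℕ) (ts : List ℕ) : Set where
    field
      arity : tally (λ _ → true) ts ≡ (if P t then 2 else 3)
      byD   : tally D ts ≡ first (D t) (t ≡ᵇ 0)
      byOld : ∀ {i} → i < suc n → tally (_≡ᵇ i) ts ≡ old t i
      byTop : tally (_≡ᵇ suc n) ts ≡ last t (p ≡ᵇ s)
  open Good public

  tally-swap : ∀ (A : ℕ → Bool) a b ts → tally A (a ∷ b ∷ ts) ≡ tally A (b ∷ a ∷ ts)
  tally-swap A a b ts = begin
    b2n (A a) + (b2n (A b) + tally A ts) ≡⟨ sym (+-assoc (b2n (A a)) (b2n (A b)) _) ⟩
    b2n (A a) + b2n (A b) + tally A ts   ≡⟨ cong (_+ tally A ts) (+-comm (b2n (A a)) (b2n (A b))) ⟩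
    b2n (A b) + b2n (A a) + tally A ts   ≡⟨ +-assoc (b2n (A b)) (b2n (A a)) _ ⟩
    b2n (A b) + (b2n (A a) + tally A ts) ∎
    where open ≡-Reasoning

  good-swap : ∀ {p t a b ts} → Good p t (a ∷ b ∷ ts) → Good p t (b ∷ a ∷ ts)
  good-swap {a = a} {b} {ts} g = record
    { arity = trans (tally-swap (λ _ → true) b a ts) (arity g)
    ; byD   = trans (tally-swap D b a ts) (byD g)
    ; byOld = λ {i} h → trans (tally-swap (_≡ᵇ i) b a ts) (byOld g h)
    ; byTop = trans (tally-swap (_≡ᵇ suc n) b a ts) (byTop g)
    }

  self : ℕ → List ℕ
  self t = when (not (P t)) t

  arm-self : ∀ t z → when (isOne (arm t) ∨ false) t ++ when (isX (arm t)) z ≡ self t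
  arm-self t z with P t
  ... | true  = refl
  ... | false = refl

  ≤⇒≤ᵇ≡true : ∀ {i j} → i ≤ j → (i ≤ᵇ j) ≡ true
  ≤⇒≤ᵇ≡true {i} {j} h with i ≤ᵇ j in e
  ... | true  = refl
  ... | false = ⊥-elim (subst T e (≤⇒≤ᵇ h))

  >⇒≤ᵇ≡false : ∀ {i j} → j < i → (i ≤ᵇ j) ≡ false
  >⇒≤ᵇ≡false {i} {j} h with i ≤ᵇ j in e
  ... | false = refl
  ... | true  = ⊥-elim (<⇒≱ h (≤ᵇ⇒≤ i j (subst T (sym e) tt)))

  last-inner : ∀ {t} b → t ≤ n → last t b ≡ b2n (t ≡ᵇ n) + 0
  last-inner {t} b h rewrite ≤⇒≤ᵇ≡true h = refl

  good-inner : ∀ {p t} → suc t ≤ n → Good p (suc t) (2 + t ∷ t ∷ self (suc t))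
  good-inner {p} {t} h = record
    { arity = arity′
    ; byD   = trans (cong (λ k → b2n (D (2 + t)) + (b2n (D t) + k)) (tally-when D (not (P (suc t))) (suc t))) (D-inner t)
    ; byOld = λ {i} _ → cong (λ k → b2n (2 + t ≡ᵇ i) + (b2n (t ≡ᵇ i) + k)) (tally-when (_≡ᵇ i) (not (P (suc t))) (suc t))
    ; byTop = byTop′
    }
    where
    arity′ : tally (λ _ → true) (2 + t ∷ t ∷ self (suc t)) ≡ (if P (suc t) then 2 else 3)
    arity′ with P (suc t)
    ... | true  = refl
    ... | false = refl
    byTop′ : tally (_≡ᵇ suc n) (2 + t ∷ t ∷ self (suc t)) ≡ last (suc t) (p ≡ᵇ s)
    byTop′ rewrite last-inner (p ≡ᵇ s) h | tally-when (_≡ᵇ suc n) (not (P (suc t))) (suc t)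
      | ≢⇒≡ᵇ (<⇒≢ (m<n⇒m<1+n h)) | ≢⇒≡ᵇ (<⇒≢ h) | 𝔹ₚ.∧-zeroʳ (not (P (suc t))) = refl

  good-zero : ∀ {p} → Good p 0 (1 ∷ 0 ∷ [])
  good-zero {p} = record
    { arity = sym (cong (λ a → if a then 2 else 3) P-0)
    ; byD   = D-zero
    ; byOld = λ _ → refl
    ; byTop = sym (last-inner (p ≡ᵇ s) z≤n)
    }

  ≡ᵇ-shift : ∀ o k → (o + k ≡ᵇ k) ≡ (o ≡ᵇ 0)
  ≡ᵇ-shift zero    k = ≡ᵇ-refl k
  ≡ᵇ-shift (suc o) k = ≢⇒≡ᵇ (<⇒≢ (s≤s (m≤n+m k o)) ∘ sym)

  ≡ᵇ-below : ∀ o {i k} → i < k → (o + k ≡ᵇ i) ≡ false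
  ≡ᵇ-below o {i} {k} h = ≢⇒≡ᵇ (<⇒≢ (<-≤-trans h (m≤n+m k o)) ∘ sym)

  ≡ᵇ-shift-suc : ∀ o k → (o + k ≡ᵇ suc k) ≡ (o ≡ᵇ 1)
  ≡ᵇ-shift-suc zero    k = ≢⇒≡ᵇ (<⇒≢ (n<1+n k))
  ≡ᵇ-shift-suc (suc o) k = ≡ᵇ-shift o k

  -- os lists the labels of the neighbouring levels, diminished by n.
  centre : ∀ o os b {p} → (p ≡ᵇ s) ≡ b →
    tally (λ _ → true) os ≡ (if P (suc o) then 2 else 3) →
    tally D os ≡ first (D (suc o)) false →
    tally (_≡ᵇ 0) os ≡ b2n (o ≡ᵇ 0) →
    tally (_≡ᵇ 1) os ≡ top (suc o) b →
    Good p (suc o + n) (map (_+ n) os)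
  centre o os b {p} p≡s e₁ e₂ e₃ e₄ = record
    { arity = trans (sym (tally-map (λ _ → true) (_+ n) os)) (trans e₁ (cong (λ a → if a then 2 else 3) (sym (P-shift o))))
    ; byD   = trans (sym (tally-map D (_+ n) os)) (trans (tally-cong D-shift os)
                (trans e₂ (cong (λ a → first a false) (sym (D-shift (suc o))))))
    ; byOld = byOld′
    ; byTop = trans (sym (tally-map (_≡ᵇ suc n) (_+ n) os)) (trans (tally-cong (λ o → ≡ᵇ-shift-suc o n) os)
                (trans e₄ top-last))
    }
    where
    i<1+o+n : ∀ i → i ≤ n → i < suc (o + n)
    i<1+o+n i h = s≤s (≤-trans h (m≤n+m n o))
    old-centre : ∀ {i} → i < suc n → b2n (o + n ≡ᵇ i) ≡ old (suc o + n) i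
    old-centre {i} (s≤s h)
      rewrite ≢⇒≡ᵇ (<⇒≢ (m<n⇒m<1+n (i<1+o+n i h)) ∘ sym) | ≢⇒≡ᵇ (<⇒≢ (i<1+o+n i h) ∘ sym)
        | 𝔹ₚ.∧-zeroʳ (not (P (suc (o + n)))) = sym (+-identityʳ _)
    byOld′ : ∀ {i} → i < suc n → tally (_≡ᵇ i) (map (_+ n) os) ≡ old (suc o + n) i
    byOld′ {i} i<m@(s≤s h) with m≤n⇒m<n∨m≡n h
    ... | inj₁ i<n = begin
      tally (_≡ᵇ i) (map (_+ n) os)   ≡⟨ sym (tally-map (_≡ᵇ i) (_+ n) os) ⟩
      tally (λ o → o + n ≡ᵇ i) os     ≡⟨ tally-false (λ o → ≡ᵇ-below o i<n) os ⟩
      0                               ≡⟨ sym (cong b2n (≡ᵇ-below o i<n)) ⟩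
      b2n (o + n ≡ᵇ i)                ≡⟨ old-centre i<m ⟩
      old (suc o + n) i               ∎
      where open ≡-Reasoning
    ... | inj₂ refl = begin
      tally (_≡ᵇ n) (map (_+ n) os)   ≡⟨ sym (tally-map (_≡ᵇ n) (_+ n) os) ⟩
      tally (λ o → o + n ≡ᵇ n) os     ≡⟨ tally-cong (λ o → ≡ᵇ-shift o n) os ⟩
      tally (_≡ᵇ 0) os                ≡⟨ e₃ ⟩
      b2n (o ≡ᵇ 0)                    ≡⟨ sym (cong b2n (≡ᵇ-shift o n)) ⟩
      b2n (o + n ≡ᵇ n)                ≡⟨ old-centre i<m ⟩
      old (suc o + n) n               ∎
      where open ≡-Reasoning
    top-last : top (suc o) b ≡ last (suc o + n) (p ≡ᵇ s)
    top-last rewrite ≡ᵇ-shift (suc o) n | >⇒≤ᵇ≡false (s≤s (m≤n+m n o)) | m+n∸n≡m (suc o) n | p≡s = refl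

  old-new : ∀ {t i} → i < t → old t i ≡ b2n (t ≡ᵇ suc i)
  old-new {suc t} {i} (s≤s h) rewrite ≢⇒≡ᵇ (<⇒≢ (≤-<-trans h (s≤s (n≤1+n t))) ∘ sym) | ≢⇒≡ᵇ (<⇒≢ (s≤s h) ∘ sym)
    | 𝔹ₚ.∧-zeroʳ (not (P (suc t))) = +-identityʳ _

  -- What may follow a descending arm: nothing, so that the extra rung joins label 0 to itself, or
  -- another arm beginning with label 0. Either way its last level sees the labels 1 and 0.
  data Closed : Word → Set where
    end  : Closed []
    more : ∀ {a ws} → Closed ((a , 0) ∷ ws)

  along-downs : ∀ {z ws} t p → t ≤ suc n → Closed ws →
    (∀ p → s ≤ p → Along Good z p 0 ws) → s ≤ p → Along Good z p t (downs t ++ ws)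
  along-downs zero p h cl k l = k p l
  along-downs {z} {ws} (suc zero) p h cl k l = last-good cl , k (suc p) (m≤n⇒m≤1+n l)
    where
    last-good : Closed ws → Good (suc p) 0 (1 ∷ nextLabel ws ++ when (isOne (arm 0) ∨ null ws) 0 ++ when (isX (arm 0)) z)
    last-good cl rewrite P-0 with cl
    ... | end  = good-zero
    ... | more = good-zero
  along-downs {z} {ws} (suc (suc t)) p (s≤s h) cl k l =
    subst (λ ts → Good (suc p) (suc t) (2 + t ∷ t ∷ ts)) (sym (arm-self (suc t) z)) (good-inner h) ,
    along-downs (suc t) (suc p) (m≤n⇒m≤1+n h) cl k (m≤n⇒m≤1+n l)

  -- On an ascending arm the label to the left is `pred t`. At `t = 0` this gives 0, which is the
  -- end of the preceding descending arm.
  along-ups : ∀ {z a ws} c t p → t + c ≡ suc n →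
    (∀ p → s ≤ p → Along Good z p n ((a , suc n) ∷ ws)) → s ≤ p →
    Along Good z p (pred t) (ups t c ++ (a , suc n) ∷ ws)
  along-ups {z} {a} {ws} zero t p e k l =
    subst (λ t → Along Good z p t ((a , suc n) ∷ ws)) (cong pred (trans (sym e) (+-identityʳ t))) (k p l)
  along-ups {z} {a} {ws} (suc c) t p e k l =
    subst (λ ts → Good (suc p) t (pred t ∷ ts)) (sym (cong₂ _++_ (next c e′) (trans (open-end c) (arm-self t z))))
      (here-good t (subst (t ≤_) (cong pred e′) (m≤m+n t c))) ,
    along-ups c (suc t) (suc p) e′ k (m≤n⇒m≤1+n l)
    where
    e′ : suc t + c ≡ suc n
    e′ = trans (sym (+-suc t c)) e
    next : ∀ c → suc t + c ≡ suc n → nextLabel (ups (suc t) c ++ (a , suc n) ∷ ws) ≡ suc t ∷ []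
    next zero    e = cong (_∷ []) (trans (sym e) (+-identityʳ (suc t)))
    next (suc c) e = refl
    open-end : ∀ c → when (isOne (arm t) ∨ null (ups (suc t) c ++ (a , suc n) ∷ ws)) t ++ when (isX (arm t)) z
      ≡ when (isOne (arm t) ∨ false) t ++ when (isX (arm t)) z
    open-end zero    = refl
    open-end (suc c) = refl
    here-good : ∀ t → t ≤ n → Good (suc p) t (pred t ∷ suc t ∷ self t)
    here-good zero    h rewrite P-0 = good-swap good-zero
    here-good (suc t) h = good-swap (good-inner h)

  along-arms : ∀ {z a ws p} → s ≤ p →
    (∀ p → s ≤ p → Along Good z p n ((a , suc n) ∷ ws)) →
    Along Good z p (suc n) (downs (suc n) ++ ups 0 (suc n) ++ (a , suc n) ∷ ws)
  along-arms {p = p} h k = along-downs (suc n) p ≤-refl more (λ p → along-ups (suc n) 0 p refl k) h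

  along-arm : ∀ {z p} → s ≤ p → Along Good z p (suc n) (downs (suc n))
  along-arm {z} {p} h = subst (Along Good z p (suc n)) (++-identityʳ (downs (suc n)))
    (along-downs (suc n) p ≤-refl end (λ _ _ → tt) h)

  far : ∀ i {p} → s ≤ p → (suc (i + p) ≡ᵇ s) ≡ false
  far i {p} h = ≢⇒≡ᵇ (<⇒≢ (s≤s (≤-trans h (m≤n+m p i))) ∘ sym)

-- Words made of arms and a bounded centre

letters-shift : ∀ n w → letters (shift n w) ≡ letters w
letters-shift n []      = refl
letters-shift n (_ ∷ w) = cong (_ ∷_) (letters-shift n w)

NoX-++ : ∀ u {w} → NoX (letters u) → NoX (letters w) → NoX (letters (u ++ w))
NoX-++ []      _        h = h
NoX-++ (_ ∷ u) (g ∷ gs) h = g ∷ NoX-++ u gs h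

NoX-shift : ∀ n {w} → NoX (letters w) → NoX (letters (shift n w))
NoX-shift n {w} = subst NoX (sym (letters-shift n w))

All-shift : ∀ {Q : Letter → ℕ → Set} n {w} → All (λ (a , o) → Q a (o + n)) w → All (λ (a , t) → Q a t) (shift n w)
All-shift n []       = []
All-shift n (h ∷ hs) = h ∷ All-shift n hs

drop-++ : ∀ {A : Set} s (xs : List A) {ys} → s ≤ length xs → drop s (xs ++ ys) ≡ drop s xs ++ ys
drop-++ zero    xs       _       = refl
drop-++ (suc s) (x ∷ xs) (s≤s h) = drop-++ s xs h

drop-shift : ∀ n s w → drop s (shift n w) ≡ shift n (drop s w)
drop-shift n zero    w       = refl
drop-shift n (suc s) []      = refl
drop-shift n (suc s) (_ ∷ w) = drop-shift n s w

downFrom-< : ∀ b → All (_< b) (downFrom b)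
downFrom-< zero    = []
downFrom-< (suc b) = n<1+n b ∷ All.map m<n⇒m<1+n (downFrom-< b)

-- The word of a family: S, then pre, the two arms hanging together at their ends labelled 0,
-- mid, the letters X around inner, outer, and a third arm.
record Shape (pat : Pattern) : Set where
  open Pattern pat
  field
    pre mid inner outer : Word
    zᵒ xᵒ               : ℕ
    NoX-pre             : NoX (letters pre)
    NoX-mid             : NoX (letters mid)
    NoX-inner           : NoX (letters inner)
    NoX-outer           : NoX (letters outer)

  z x : ℕ
  z = zᵒ + n
  x = xᵒ + n

  right : Word
  right = shift n mid ++ (X , x) ∷ shift n inner ++ (X , x) ∷ shift n outer ++ downs (suc n)

  arms : Word
  arms = shift n pre ++ downs (suc n) ++ ups 0 (suc n) ++ right

  layout : Layout
  layout = record
    { front     = shift n pre ++ downs (suc n) ++ ups 0 (suc n) ++ shift n mid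
    ; inner     = shift n inner
    ; outer     = shift n outer ++ downs (suc n)
    ; z         = z
    ; x         = x
    ; front>0   = front>0 (shift n pre)
    ; NoX-front = NoX-++ (shift n pre) (NoX-shift n NoX-pre)
        (NoX-++ (downs (suc n)) (arm-NoX (All-downs (suc n) λ {j} _ → isX-arm j))
          (NoX-++ (ups 0 (suc n)) (arm-NoX (All-ups 0 (suc n) λ {j} _ → isX-arm j)) (NoX-shift n NoX-mid)))
    ; NoX-inner = NoX-shift n NoX-inner
    ; NoX-outer = NoX-++ (shift n outer) (NoX-shift n NoX-outer) (arm-NoX (All-downs (suc n) λ {j} _ → isX-arm j))
    }
    where
    front>0 : ∀ w {ws} → 0 < length (letters (w ++ downs (suc n) ++ ws))
    front>0 []      = z<s
    front>0 (_ ∷ _) = z<s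
    arm-NoX : ∀ {w} → All (λ ((a , _) : Letter × ℕ) → isX a ≡ false) w → NoX (letters w)
    arm-NoX []       = []
    arm-NoX (h ∷ hs) = h ∷ arm-NoX hs

  open Layout layout public hiding (z; x; inner; outer; NoX-inner; NoX-outer)

  word≡arms : word ≡ arms
  word≡arms = trans (++-assoc (shift n pre) _ _) (cong (shift n pre ++_)
    (trans (++-assoc (downs (suc n)) _ _) (cong (downs (suc n) ++_)
      (++-assoc (ups 0 (suc n)) _ _))))

  letters-Ξ : Ξ ≡ S ∷ letters arms
  letters-Ξ = cong (S ∷_) (trans (sym letters-word) (cong letters word≡arms))

-- The labels of the levels after the first X are B + n − 1, …, 0, and all labels are below M + n.
-- A level labelled o + n with o > 0 has top o b neighbours labelled n + 1, where b tells whether it is s.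
record Plan {pat : Pattern} (shape : Shape pat) : Set where
  open Pattern pat
  open Shape shape
  open Neighbourhoods lad
  open Labelling lad τ
  field
    s t₀ B M  : ℕ
    top       : ℕ → Bool → ℕ
  open Rules pat s top
  field
    along     : Along Good z 0 z arms
    good-0    : Good 0 z (nth (labels arms) 0 ∷ x ∷ x ∷ [])
    back      : labels (shift n inner) ++ x ∷ labels (shift n outer) ++ downFrom (suc n) ≡ downFrom (B + n)
    2≤B       : 2 ≤ B
    B≤M       : B ≤ M
    -- This is the `total` of a `Schedule` with `m = n + 1`, `d = r - s` and `ℓ = 1 + r + B + n`;
    -- both `r` and `n` cancel, so the parameter of the family disappears.
    total     : 3 + t₀ ≡ s + B
    0<xᵒ      : 0 < xᵒ
    xᵒ<B      : xᵒ < B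
    s≤pre     : s ≤ length pre
    -- The word starts at position 1, so dropping `s` letters leaves the positions after `s`. Their
    -- labels recur behind the first X.
    late-pre  : All (λ (_ , o) → o < B) (drop s pre)
    late-mid  : All (λ (_ , o) → o < B) mid
    pre-<M    : All (λ (_ , o) → o < M) pre
    z<M       : zᵒ < M

  back-labels : labels (shift n inner) ++ x ∷ labels (shift n outer ++ downs (suc n)) ≡ downFrom (B + n)
  back-labels = trans (cong (λ ts → labels (shift n inner) ++ x ∷ ts)
    (trans (map-++ proj₂ (shift n outer) _) (cong (labels (shift n outer) ++_) (labels-downs (suc n))))) back

  suc-n<B+n : suc n < B + n
  suc-n<B+n = +-monoˡ-≤ n 2≤B

  All-right : ∀ {k} → B ≤ k → All (λ (_ , o) → o < k) mid → All (λ (_ , t) → t < k + n) right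
  All-right {k} B≤k h = All-++⁺ (All-shift {λ _ t → t < k + n} n (All.map (+-monoˡ-< n) h))
    (+-monoˡ-< n (<-≤-trans xᵒ<B B≤k) ∷ All.map (λ l → <-≤-trans l (+-monoˡ-≤ n B≤k))
      (unlabels (subst (All (_< B + n)) (trans (sym back-labels) (sym (map-++ proj₂ (shift n inner) _))) (downFrom-< (B + n)))))
    where
    unlabels : ∀ {b w} → All (_< b) (labels w) → All (λ ((_ , t) : Letter × ℕ) → t < b) w
    unlabels {w = []}    []       = []
    unlabels {w = _ ∷ _} (h ∷ hs) = h ∷ unlabels hs

  All-arms : ∀ {k} → B ≤ k → All (λ (_ , o) → o < k) mid →
    All (λ (_ , t) → t < k + n) (downs (suc n) ++ ups 0 (suc n) ++ right)
  All-arms {k} B≤k h = All-++⁺ (All-downs (suc n) arm<) (All-++⁺ (All-ups 0 (suc n) arm<) (All-right B≤k h))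
    where
    arm< : ∀ {j} → j < suc n → j < k + n
    arm< h = <-trans h (<-≤-trans suc-n<B+n (+-monoˡ-≤ n B≤k))

  late : ∀ {p} → s < p → p < ℓ → τ p < B + n
  late = lookup-drop {_< B + n} s (subst (All (λ (_ , t) → t < B + n)) (sym drop-word)
    (All-++⁺ (All-shift {λ _ t → t < B + n} n (All.map (+-monoˡ-< n) late-pre)) (All-arms ≤-refl late-mid)))
    where
    drop-word : drop s word ≡ shift n (drop s pre) ++ downs (suc n) ++ ups 0 (suc n) ++ right
    drop-word = trans (cong (drop s) word≡arms)
      (trans (drop-++ s (shift n pre) (subst (s ≤_) (sym (length-map _ pre)) s≤pre))
        (cong (_++ downs (suc n) ++ ups 0 (suc n) ++ right) (drop-shift n s pre)))

  bounded : ∀ {p} → p < ℓ → τ p < M + n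
  bounded {zero}  _ = +-monoˡ-< n z<M
  bounded {suc p} h = lookup-drop {_< M + n} 0 (subst (All (λ (_ , t) → t < M + n)) (sym word≡arms)
    (All-++⁺ (All-shift {λ _ t → t < M + n} n (All.map (+-monoˡ-< n) pre-<M))
      (All-arms B≤M (All.map (λ l → <-≤-trans l B≤M) late-mid)))) z<s h

  seek : ∀ {t} → t < B + n → ∃ λ q → q < ℓ × r < q × τ q ≡ t
  seek = find back-labels

  mate-0 : zᵒ < B → ∃ λ q → q < ℓ × q ≢ 0 × τ 0 ≡ τ q
  mate-0 h = let q , q< , r<q , e = seek (+-monoˡ-< n h) in q , q< , m<n⇒n≢0 r<q , sym e

  s≤r : s ≤ r
  s≤r = m≤n⇒m≤1+n (≤-trans s≤pre (subst (length pre ≤_)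
    (sym (trans (length-map proj₁ (shift n pre ++ _)) (trans (length-++ (shift n pre))
      (cong (_+ length (downs (suc n) ++ ups 0 (suc n) ++ shift n mid)) (length-map _ pre)))))
    (m≤m+n (length pre) _)))

  start-uniform : (∀ t → D t ≡ true) → Refined 0 (λ v w → D (τ (pos v)) ≡ D (τ (pos w))) (λ v → D (τ (pos v)))
  start-uniform h = refined-resp (λ v w → both tt (trans (h (τ (pos v))) (sym (h (τ (pos w))))))
    (λ v → sym (h (τ (pos v)))) refined-start

  -- `P` marks the labels of degree 2, so one round from the uniform colouring produces exactly `D`.
  -- Levels labelled 0 and 1 show that both degrees occur.
  start-degrees : (∀ t → D t ≡ P t) → D 1 ≡ false →
    Refined 1 (λ v w → D (τ (pos v)) ≡ D (τ (pos w))) (λ v → D (τ (pos v)))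
  start-degrees D≡P D-1 = refined-resp (λ v w → mk⇔ proj₂ (tt ,_)) (λ _ → refl)
    (refined-step (λ v → D (τ (pos v))) refined-start
      (λ v w _ → ⇔-rewrite (degree v) (degree w) (separating (λ a → if a then 2 else 3) λ ()))
      (λ _ _ _ _ → tt)
      (at-label 0 (<-trans z<s suc-n<B+n) , at-label 1 (≤-<-trans (s≤s z≤n) suc-n<B+n) ,
       trans (cong D (at-label-τ 0 _)) (trans (D≡P 0) P-0) , trans (cong D (at-label-τ 1 _)) D-1 , tt))
    where
    degree : ∀ v → degreeIn (λ _ → true) v ≡ (if D (τ (pos v)) then 2 else 3)
    degree v = trans (degreeIn-label (trans (proj₁ τ-X) (sym (proj₂ τ-X))) (λ _ → true) v)
      (trans (arity (lookup-near {Good} (subst (Along Good z 0 z) (sym word≡arms) along)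
        (subst (λ w → Good 0 z (nth (labels w) 0 ∷ x ∷ x ∷ [])) (sym word≡arms) good-0) (pos< v)))
        (cong (λ a → if a then 2 else 3) (sym (D≡P (τ (pos v))))))
    at-label : ∀ t → t < B + n → V
    at-label t h = proj₁ (coords-surjective (proj₁ (proj₂ (seek h))) (z<s {1}))
    at-label-τ : ∀ t h → τ (pos (at-label t h)) ≡ t
    at-label-τ t h = trans (cong τ (cong proj₁ (proj₂ (coords-surjective (proj₁ (proj₂ (seek h))) (z<s {1})))))
      (proj₂ (proj₂ (proj₂ (seek h))))

record Separation {pat : Pattern} {shape : Shape pat} (plan : Plan shape) : Set where
  open Pattern pat
  open Shape shape
  open Plan plan
  open Neighbourhoods lad
  open Labelling lad τ
  open Rules pat s top
  field
    start    : Refined t₀ (λ v w → D (τ (pos v)) ≡ D (τ (pos w))) (λ v → D (τ (pos v)))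
    sᵒ       : ℕ
    τ-s      : τ s ≡ suc sᵒ + n
    top-≢    : top (suc sᵒ) true ≢ top (suc sᵒ) false
    -- Each part of `D` keeps a label beyond `n + 1`, from which the labels up to `n + 1` are
    -- properly split off; this gives `unsettled`.
    coarse   : ∀ i → ∃ λ q → q < ℓ × suc n < τ q × D i ≡ D (τ q)
    settled  : ∀ {t t′} → suc n < t → t < M + n → suc n < t′ → t′ < M + n → D t ≡ D t′ → t ≡ t′
    before-s : ∀ {p q} → p < s → q < ℓ → τ p ≡ τ q → p ≡ q ⊎ q ≡ s
    mate-s   : ∃ λ q → q < ℓ × q ≢ s × τ s ≡ τ q
    X-label  : s ≡ 0 → All (λ (a , o) → isX a ≡ (o ≡ᵇ xᵒ)) (pre ++ mid ++ inner ++ outer)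

  good : ∀ {p} → p < ℓ → Good p (τ p) (near p)
  good = lookup-near {Good} (subst (Along Good z 0 z) (sym word≡arms) along)
    (subst (λ w → Good 0 z (nth (labels w) 0 ∷ x ∷ x ∷ [])) (sym word≡arms) good-0)

  X-labels : s ≡ 0 → ∀ {p} → 0 < p → p < ℓ → isX (at Ξ p) ≡ (τ p ≡ᵇ x)
  X-labels e = lookup-All {λ a t → isX a ≡ (t ≡ᵇ x)} (subst (All (λ (a , t) → isX a ≡ (t ≡ᵇ x))) (sym word≡arms)
    (All-++⁺ (shifted (++⁻ˡ pre (X-label e)))
      (All-++⁺ (All-downs (suc n) arm-X) (All-++⁺ (All-ups 0 (suc n) arm-X)
        (All-++⁺ (shifted (++⁻ˡ mid (++⁻ʳ pre (X-label e))))
          (sym (≡ᵇ-refl x) ∷ All-++⁺ (shifted (++⁻ˡ inner (++⁻ʳ mid (++⁻ʳ pre (X-label e)))))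
            (sym (≡ᵇ-refl x) ∷ All-++⁺ (shifted (++⁻ʳ inner (++⁻ʳ mid (++⁻ʳ pre (X-label e)))))
              (All-downs (suc n) arm-X))))))))
    where
    ≡ᵇ-+ : ∀ o k j → (o + j ≡ᵇ k + j) ≡ (o ≡ᵇ k)
    ≡ᵇ-+ o k zero rewrite +-identityʳ o | +-identityʳ k = refl
    ≡ᵇ-+ o k (suc j) rewrite +-suc o j | +-suc k j = ≡ᵇ-+ o k j
    shifted : ∀ {w} → All (λ (a , o) → isX a ≡ (o ≡ᵇ xᵒ)) w → All (λ (a , t) → isX a ≡ (t ≡ᵇ x)) (shift n w)
    shifted h = All-shift {λ a t → isX a ≡ (t ≡ᵇ x)} n (All.map (λ {(_ , o)} e → trans e (sym (≡ᵇ-+ o xᵒ n))) h)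
    arm-X : ∀ {j} → j < suc n → isX (arm j) ≡ (j ≡ᵇ x)
    arm-X {j} h = trans (isX-arm j) (sym (≢⇒≡ᵇ (<⇒≢ (<-≤-trans h (+-monoˡ-≤ n 0<xᵒ)))))

  schedule : Schedule lad
  schedule = record
    { τ = τ ; D = D ; m = suc n ; s = s ; d = r ∸ s ; t₀ = t₀
    ; τ-r = trans (proj₁ τ-X) (sym (proj₂ τ-X))
    ; start = start
    ; old = old ; last = last ; first = first
    ; near-D = λ h → byD (good h)
    ; first-≢ = first-≢
    ; near-i = λ h → byOld (good h)
    ; old-new = old-new
    ; near-m = λ h → byTop (good h)
    ; last-≢ = λ e → top-≢ (trans (sym (last-s true)) (trans e (last-s false)))
    ; unsettled = λ {i} h →
        let p , p< , _ , e = seek (≤-<-trans h suc-n<B+n) ; q , q< , l , f = coarse i in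
        p , q , p< , q< , e , ≤-<-trans h l , trans (cong D e) f
    ; settled = λ p< q< a b → settled a (bounded p<) b (bounded q<)
    ; s+d≡r = m+[n∸m]≡n s≤r
    ; before-s = before-s
    ; mate-s = mate-s
    ; mate = λ {p} s<p p≤r → let q , q< , r<q , e = seek (late s<p (≤-<-trans p≤r r<ℓ)) in
        q , q< , ≤-<-trans p≤r r<q , sym e
    ; after-r = back-injective back-labels
    ; X-label = λ e a b c d f → trans (X-labels e a b) (trans (cong (_≡ᵇ x) f) (sym (X-labels e c d)))
    ; total = total′
    }
    where
    last-s : ∀ b → last (τ s) b ≡ top (suc sᵒ) b
    last-s b rewrite τ-s | ≡ᵇ-shift (suc sᵒ) n | >⇒≤ᵇ≡false (s≤s (m≤n+m n sᵒ)) | m+n∸n≡m (suc sᵒ) n = refl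
    total′ : 2 + (r ∸ s + suc (suc n + t₀)) ≡ ℓ
    total′ = +-cancelˡ-≡ s _ _ (begin
      s + (2 + (r ∸ s + suc (suc n + t₀))) ≡⟨ rearrange₁ s (r ∸ s) n t₀ ⟩
      suc (s + (r ∸ s) + (3 + t₀ + n))     ≡⟨ cong₂ (λ a b → suc (a + (b + n))) (m+[n∸m]≡n s≤r) total ⟩
      suc (r + (s + B + n))                ≡⟨ rearrange₂ s r B n ⟩
      s + suc (r + (B + n))                ≡⟨ cong (s +_) (sym (ℓ≡r+b back-labels)) ⟩
      s + ℓ                                ∎)
      where
      open ≡-Reasoning
      open +-*-Solver
      rearrange₁ : ∀ s d n t → s + (2 + (d + suc (suc n + t))) ≡ suc (s + d + (3 + t + n))
      rearrange₁ = solve 4 (λ s d n t → s :+ (con 2 :+ (d :+ (con 1 :+ (con 1 :+ n :+ t)))) :=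
        con 1 :+ (s :+ d :+ (con 3 :+ t :+ n))) refl
      rearrange₂ : ∀ s r b n → suc (r + (s + b + n)) ≡ s + suc (r + (b + n))
      rearrange₂ = solve 4 (λ s r b n → con 1 :+ (r :+ (s :+ b :+ n)) := s :+ (con 1 :+ (r :+ (b :+ n)))) refl

-- The six families

third : ℕ → Bool
third 0                   = true
third 1                   = false
third 2                   = false
third (suc (suc (suc t))) = third t

third-+ : ∀ k o → third (o + k * 3) ≡ third o
third-+ zero    o = cong third (+-identityʳ o)
third-+ (suc k) o = trans (cong third (trans (+-comm o (3 + k * 3)) (cong (3 +_) (+-comm (k * 3) o)))) (third-+ k o)

-- Letter 0 occurs only at the ends of arms, so degree 2 means label 0. Comparing degrees already
-- splits off label 0, hence `D` is everything.
only-end : ℕ → Pattern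
only-end n = record
  { n = n ; P = _≡ᵇ 0 ; D = λ _ → true ; first = λ _ b → if b then 2 else 3
  ; P-0 = refl ; P-shift = λ _ → refl ; D-shift = λ _ → refl
  ; D-inner = λ _ → refl ; D-zero = refl ; first-≢ = λ _ ()
  }

-- A level of degree 3 has exactly one neighbour of degree 2, whereas a level of degree 2 has one
-- only if its label is 0; so the round after the degrees breaks only the degree 2 class. Label 0
-- has degree 2, and the entry 2 in `first` is a default chosen to differ from 1.
every-third : ℕ → Pattern
every-third k = record
  { n = k * 3 ; P = third ; D = third
  ; first = λ d b → if d then (if b then 1 else 0) else (if b then 2 else 1)
  ; P-0 = refl ; P-shift = λ o → third-+ k (suc o) ; D-shift = third-+ k
  ; D-inner = D-inner ; D-zero = refl ; first-≢ = λ { true () ; false () }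
  }
  where
  D-inner : ∀ t → b2n (third (2 + t)) + (b2n (third t) + b2n (not (third (suc t)) ∧ third (suc t))) ≡
    (if third (suc t) then 0 else 1)
  D-inner 0 = refl
  D-inner 1 = refl
  D-inner 2 = refl
  D-inner (suc (suc (suc t))) = D-inner t

only-end-settled : ∀ n {t t′} → suc n < t → t < 3 + n → suc n < t′ → t′ < 3 + n → t ≡ t′
only-end-settled n a b c d = trans (≤-antisym (≤-pred b) a) (sym (≤-antisym (≤-pred d) c))

-- Only the labels `n + 2` and `n + 3` remain, of degrees 3 and 2, and `third` tells them apart.
every-third-settled : ∀ k {t t′} → suc (k * 3) < t → t < 4 + k * 3 → suc (k * 3) < t′ → t′ < 4 + k * 3 →
  third t ≡ third t′ → t ≡ t′
every-third-settled k a b c d e with m≤n⇒m<n∨m≡n a | m≤n⇒m<n∨m≡n c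
... | inj₂ f | inj₂ g = trans (sym f) g
... | inj₁ f | inj₁ g = trans (≤-antisym (≤-pred b) f) (sym (≤-antisym (≤-pred d) g))
... | inj₁ f | inj₂ refl = true≢false
  (trans (cong third (≤-antisym (≤-pred b) f)) (third-+ k 3)) (trans e (third-+ k 2))
... | inj₂ refl | inj₁ g = true≢false
  (trans (cong third (≤-antisym (≤-pred d) g)) (third-+ k 3)) (trans (sym e) (third-+ k 2))

by-offset : (Bool → ℕ) → (Bool → ℕ) → (Bool → ℕ) → ℕ → Bool → ℕ
by-offset f g h 1 = f
by-offset f g h 2 = g
by-offset f g h _ = h

mark : ℕ → ℕ → Bool → ℕ
mark j k b = if b then j else k

letters-downs-only-end : ∀ n k ws → letters (Pattern.downs (only-end n) (suc k) ++ ws) ≡ 1^ k ++ O ∷ letters ws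
letters-downs-only-end n zero    ws = refl
letters-downs-only-end n (suc k) ws = cong (I ∷_) (letters-downs-only-end n k ws)

letters-ups-only-end : ∀ n t k ws → letters (Pattern.ups (only-end n) (suc t) k ++ ws) ≡ 1^ k ++ letters ws
letters-ups-only-end n t zero    ws = refl
letters-ups-only-end n t (suc k) ws = cong (I ∷_) (letters-ups-only-end n (suc t) k ws)

arm-third : ∀ k o → (if third (o + k * 3) then O else I) ≡ (if third o then O else I)
arm-third k o = cong (λ b → if b then O else I) (third-+ k o)

letters-downs-every-third : ∀ n k ws → letters (Pattern.downs (every-third n) (suc (k * 3)) ++ ws) ≡
  ((O ∷ I ∷ I ∷ []) ^^ k) ++ O ∷ letters ws
letters-downs-every-third n zero    ws = refl
letters-downs-every-third n (suc k) ws = cong₂ _∷_ (arm-third k 3) (cong₂ _∷_ (arm-third k 2)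
  (cong₂ _∷_ (arm-third k 1) (letters-downs-every-third n k ws)))

letters-ups-every-third : ∀ n j k ws → letters (Pattern.ups (every-third n) (suc (j * 3)) (k * 3) ++ ws) ≡
  ((I ∷ I ∷ O ∷ []) ^^ k) ++ letters ws
letters-ups-every-third n j zero    ws = refl
letters-ups-every-third n j (suc k) ws = cong₂ _∷_ (arm-third j 1) (cong₂ _∷_ (arm-third j 2)
  (cong₂ _∷_ (arm-third j 3) (letters-ups-every-third n (suc j) k ws)))

letters-arm-only-end : ∀ k → letters (Pattern.downs (only-end k) (suc k)) ≡ 1^ k ++ O ∷ []
letters-arm-only-end k = trans (cong letters (sym (++-identityʳ (Pattern.downs (only-end k) (suc k)))))
  (letters-downs-only-end k k [])

letters-arm-every-third : ∀ k → letters (Pattern.downs (every-third k) (suc (k * 3))) ≡ ((O ∷ I ∷ I ∷ []) ^^ k) ++ O ∷ []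
letters-arm-every-third k = trans (cong letters (sym (++-identityʳ (Pattern.downs (every-third k) (suc (k * 3))))))
  (letters-downs-every-third k k [])

1^-++ : ∀ k {w} → 1^ k ++ I ∷ w ≡ I ∷ 1^ k ++ w
1^-++ zero    = refl
1^-++ (suc k) = cong (I ∷_) (1^-++ k)

long : ∀ {pat} {shape : Shape pat} {plan : Plan shape} → Separation plan → ∀ {Ξ} →
  letters (Shape.arms shape) ≡ Ξ → LongRefinement (G (S ∷ Ξ))
long {shape = shape} sep e = subst (LongRefinement ∘ G) (trans (Shape.letters-Ξ shape) (cong (S ∷_) e))
  (Run.long-refinement (Separation.schedule sep))

-- There are no three arms here: levels 0 and 2 are folded around level 1, the only one with letter
-- 0, and all later levels share label 2. The schedule is therefore given directly.
module Family₁ where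

  lad : Ladder (S ∷ O ∷ I ∷ I ∷ X ∷ X ∷ [])
  lad = ladder {O ∷ I ∷ I ∷ []} {[]} {[]} z<s (refl ∷ refl ∷ refl ∷ []) [] []

  τ : ℕ → ℕ
  τ = nth (1 ∷ 0 ∷ 1 ∷ 2 ∷ 2 ∷ 2 ∷ [])

  open Neighbourhoods lad
  open Labelling lad τ

  cases : (Q : ℕ → Set) → Q 0 → Q 1 → Q 2 → Q 3 → Q 4 → Q 5 → ∀ {p} → p < 6 → Q p
  cases Q a b c d e f {0} _ = a
  cases Q a b c d e f {1} _ = b
  cases Q a b c d e f {2} _ = c
  cases Q a b c d e f {3} _ = d
  cases Q a b c d e f {4} _ = e
  cases Q a b c d e f {5} _ = f
  cases Q a b c d e f {suc (suc (suc (suc (suc (suc _)))))} (s≤s (s≤s (s≤s (s≤s (s≤s (s≤s ()))))))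

  last : ℕ → Bool → ℕ
  last 0 = mark 2 2
  -- Level 2 sees its own label 1 across its rung, level 0 sees the labels 0, 2, 2; hence `s` is 2.
  last 1 = mark 1 0
  last _ = mark 1 1

  schedule : Schedule lad
  schedule = record
    { τ = τ ; D = λ _ → true ; m = 1 ; s = 2 ; d = 2 ; t₀ = 0 ; τ-r = refl
    ; start = refined-resp (λ _ _ → both tt refl) (λ _ → refl) refined-start
    ; old = λ t i → b2n (t ≡ᵇ suc i) ; last = last ; first = λ _ → mark 2 3
    ; near-D = cases (λ p → tally (λ _ → true) (near p) ≡ mark 2 3 (τ p ≡ᵇ 0)) refl refl refl refl refl refl
    ; first-≢ = λ _ ()
    ; near-i = λ { h (s≤s z≤n) → cases (λ p → tally (_≡ᵇ 0) (near p) ≡ b2n (τ p ≡ᵇ 1)) refl refl refl refl refl refl h }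
    ; old-new = λ _ → refl
    ; near-m = cases (λ p → tally (_≡ᵇ 1) (near p) ≡ last (τ p) (p ≡ᵇ 2)) refl refl refl refl refl refl
    ; last-≢ = λ ()
    ; unsettled = λ
      { {0} _ → 1 , 0 , from-yes (1 <? 6) , z<s , refl , z<s , refl
      ; {1} _ → 0 , 3 , z<s , from-yes (3 <? 6) , refl , s<s z<s , refl
      ; {suc (suc _)} (s≤s ()) }
    ; settled = λ p< q< a b _ → trans (≤-antisym (≤2 p<) a) (sym (≤-antisym (≤2 q<) b))
    ; s+d≡r = refl
    ; before-s = λ
      { {0} _ q< → cases (λ q → 1 ≡ τ q → 0 ≡ q ⊎ q ≡ 2)
          (λ _ → inj₁ refl) (λ ()) (λ _ → inj₂ refl) (λ ()) (λ ()) (λ ()) q<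
      ; {1} _ q< → cases (λ q → 0 ≡ τ q → 1 ≡ q ⊎ q ≡ 2)
          (λ ()) (λ _ → inj₁ refl) (λ ()) (λ ()) (λ ()) (λ ()) q<
      ; {suc (suc _)} (s≤s (s≤s ())) }
    ; mate-s = 0 , z<s , (λ ()) , refl
    ; mate = λ { {3} _ _ → 5 , ≤-refl , from-yes (3 <? 5) , refl
               ; {4} _ _ → 5 , ≤-refl , from-yes (4 <? 5) , refl
               ; {0} () ; {1} (s≤s ()) ; {2} (s≤s (s≤s ()))
               ; {suc (suc (suc (suc (suc _))))} _ (s≤s (s≤s (s≤s (s≤s ())))) }
    ; after-r = λ a b c d _ → trans (≤-antisym (≤-pred b) a) (sym (≤-antisym (≤-pred d) c))
    ; X-label = λ ()
    ; total = refl
    }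
    where
    ≤2 : ∀ {p} → p < 6 → τ p ≤ 2
    ≤2 = cases (λ p → τ p ≤ 2) (s≤s z≤n) z≤n (s≤s z≤n) ≤-refl ≤-refl ≤-refl

module Family₂ (k : ℕ) where

  shape : Shape (only-end k)
  shape = record
    { pre = [] ; mid = [] ; inner = (I , 2) ∷ [] ; outer = [] ; zᵒ = 1 ; xᵒ = 1
    ; NoX-pre = [] ; NoX-mid = [] ; NoX-inner = refl ∷ [] ; NoX-outer = []
    }

  plan : Plan shape
  plan = record
    { s = 0 ; t₀ = 0 ; B = 3 ; M = 3 ; top = top
    ; along = along-arms z≤n (λ p h →
        centre 0 (0 ∷ 2 ∷ 1 ∷ []) false (far 0 h) refl refl refl refl ,
        centre 1 (1 ∷ 1 ∷ 2 ∷ []) false (far 1 h) refl refl refl refl ,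
        centre 0 (2 ∷ 0 ∷ 1 ∷ []) false (far 2 h) refl refl refl refl ,
        along-arm (≤-trans h (m≤n+m p 3)))
    ; good-0 = centre 0 (0 ∷ 1 ∷ 1 ∷ []) true refl refl refl refl refl
    ; back = refl ; total = refl ; 2≤B = from-yes (2 ≤? 3) ; B≤M = from-yes (3 ≤? 3)
    ; 0<xᵒ = z<s ; xᵒ<B = from-yes (1 <? 3) ; z<M = from-yes (1 <? 3) ; s≤pre = from-yes (0 ≤? 0)
    ; late-pre = []
    ; late-mid = []
    ; pre-<M = []
    }
    where
    -- Offset 1 is shared by level 0 and the X levels. Level 0 sees offset 1 twice, in the spokes,
    -- but an X level sees it only at level 0.
    top = by-offset (mark 2 1) (mark 2 2) (mark 0 0)
    open Rules (only-end k) 0 top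

  separation : Separation plan
  separation = record
    { start = Plan.start-uniform plan (λ _ → refl)
    ; sᵒ = 0 ; τ-s = refl ; top-≢ = λ ()
    ; coarse = λ _ → let q , q< , _ , e = Plan.seek plan {2 + k} ≤-refl in
        q , q< , ≤-reflexive (sym e) , refl
    ; settled = λ a b c d _ → only-end-settled k a b c d
    ; before-s = λ ()
    ; mate-s = Plan.mate-0 plan (from-yes (1 <? 3))
    ; X-label = λ _ → refl ∷ []
    }

  long-refinement : LongRefinement (G (S ∷ 1^ k ++ O ∷ O ∷ 1^ k ++ X ∷ I ∷ X ∷ 1^ k ++ O ∷ []))
  long-refinement = long separation (trans (letters-downs-only-end k k _) (cong (λ w → 1^ k ++ O ∷ O ∷ w)
    (trans (letters-ups-only-end k 0 k _) (cong (λ w → 1^ k ++ X ∷ I ∷ X ∷ w) (letters-arm-only-end k)))))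

module Family₃ (k : ℕ) where

  shape : Shape (only-end k)
  shape = record
    { pre = (I , 2) ∷ (I , 1) ∷ [] ; mid = [] ; inner = [] ; outer = [] ; zᵒ = 2 ; xᵒ = 1
    ; NoX-pre = refl ∷ refl ∷ [] ; NoX-mid = [] ; NoX-inner = [] ; NoX-outer = []
    }

  plan : Plan shape
  plan = record
    { s = 1 ; t₀ = 0 ; B = 2 ; M = 3 ; top = top
    ; along = centre 1 (2 ∷ 1 ∷ 2 ∷ []) true refl refl refl refl refl ,
        centre 0 (2 ∷ 0 ∷ 1 ∷ []) false refl refl refl refl refl ,
        along-arms (s≤s z≤n) (λ p h →
        centre 0 (0 ∷ 1 ∷ 2 ∷ []) false (far 0 h) refl refl refl refl ,
        centre 0 (1 ∷ 0 ∷ 2 ∷ []) false (far 1 h) refl refl refl refl ,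
        along-arm (≤-trans h (m≤n+m p 2)))
    ; good-0 = centre 1 (2 ∷ 1 ∷ 1 ∷ []) false refl refl refl refl refl
    ; back = refl ; total = refl ; 2≤B = from-yes (2 ≤? 2) ; B≤M = from-yes (2 ≤? 3)
    ; 0<xᵒ = z<s ; xᵒ<B = from-yes (1 <? 2) ; z<M = from-yes (2 <? 3) ; s≤pre = from-yes (1 ≤? 2)
    ; late-pre = from-yes (1 <? 2) ∷ []
    ; late-mid = []
    ; pre-<M = from-yes (2 <? 3) ∷ from-yes (1 <? 3) ∷ []
    }
    where
    -- Offset 2 is shared by levels 0 and 1 only; level 0 sees offset 1 at both X levels, level 1
    -- only at its successor. The wave runs to the right, so `s` is 1 and level 0 is left alone with
    -- its label.
    top = by-offset (mark 1 1) (mark 1 2) (mark 0 0)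
    open Rules (only-end k) 1 top

  separation : Separation plan
  separation = record
    { start = Plan.start-uniform plan (λ _ → refl)
    ; sᵒ = 1 ; τ-s = refl ; top-≢ = λ ()
    ; coarse = λ _ → 0 , z<s , ≤-refl , refl
    ; settled = λ a b c d _ → only-end-settled k a b c d
    ; before-s = before-s
    ; mate-s = 0 , z<s , (λ ()) , refl
    ; X-label = λ ()
    }
    where
    open Shape shape
    before-s : ∀ {p q} → p < 1 → q < length Ξ → τ p ≡ τ q → p ≡ q ⊎ q ≡ 1
    before-s {0} {0} _ _ _ = inj₁ refl
    before-s {0} {1} _ _ _ = inj₂ refl
    before-s {0} {suc (suc q)} _ l e = ⊥-elim (<-irrefl refl (subst (_< 2 + k) (sym e) (Plan.late plan (s≤s z<s) l)))
    before-s {suc _} (s≤s ())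

  long-refinement : LongRefinement (G (S ∷ 1^ k ++ I ∷ I ∷ O ∷ O ∷ 1^ k ++ X ∷ X ∷ 1^ k ++ O ∷ []))
  long-refinement = long separation (trans (cong (λ w → I ∷ I ∷ w)
    (trans (letters-downs-only-end k k _) (cong (λ w → 1^ k ++ O ∷ O ∷ w)
    (trans (letters-ups-only-end k 0 k _) (cong (λ w → 1^ k ++ X ∷ X ∷ w) (letters-arm-only-end k))))))
    (trans (cong (I ∷_) (sym (1^-++ k))) (sym (1^-++ k))))

module Family₄ (k : ℕ) where

  shape : Shape (only-end k)
  shape = record
    { pre = [] ; mid = (I , 1) ∷ [] ; inner = [] ; outer = (I , 1) ∷ [] ; zᵒ = 1 ; xᵒ = 2
    ; NoX-pre = [] ; NoX-mid = refl ∷ [] ; NoX-inner = [] ; NoX-outer = refl ∷ []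
    }

  plan : Plan shape
  plan = record
    { s = 0 ; t₀ = 0 ; B = 3 ; M = 3 ; top = top
    ; along = along-arms z≤n (λ p h →
        centre 0 (0 ∷ 2 ∷ 1 ∷ []) false (far 0 h) refl refl refl refl ,
        centre 1 (1 ∷ 2 ∷ 1 ∷ []) false (far 1 h) refl refl refl refl ,
        centre 1 (2 ∷ 1 ∷ 1 ∷ []) false (far 2 h) refl refl refl refl ,
        centre 0 (2 ∷ 0 ∷ 1 ∷ []) false (far 3 h) refl refl refl refl ,
        along-arm (≤-trans h (m≤n+m p 4)))
    ; good-0 = centre 0 (0 ∷ 2 ∷ 2 ∷ []) true refl refl refl refl refl
    ; back = refl ; total = refl ; 2≤B = from-yes (2 ≤? 3) ; B≤M = from-yes (3 ≤? 3)
    ; 0<xᵒ = z<s ; xᵒ<B = from-yes (2 <? 3) ; z<M = from-yes (1 <? 3) ; s≤pre = from-yes (0 ≤? 0)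
    ; late-pre = []
    ; late-mid = from-yes (1 <? 3) ∷ []
    ; pre-<M = []
    }
    where
    -- Besides level 0, offset 1 occurs at two levels with letter 1, each seeing itself across its
    -- rung. Level 0 sees the offsets 0, 2, 2.
    top = by-offset (mark 0 1) (mark 2 2) (mark 0 0)
    open Rules (only-end k) 0 top

  separation : Separation plan
  separation = record
    { start = Plan.start-uniform plan (λ _ → refl)
    ; sᵒ = 0 ; τ-s = refl ; top-≢ = λ ()
    ; coarse = λ _ → let q , q< , _ , e = Plan.seek plan {2 + k} ≤-refl in
        q , q< , ≤-reflexive (sym e) , refl
    ; settled = λ a b c d _ → only-end-settled k a b c d
    ; before-s = λ ()
    ; mate-s = Plan.mate-0 plan (from-yes (1 <? 3))
    ; X-label = λ _ → refl ∷ refl ∷ []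
    }

  long-refinement : LongRefinement (G (S ∷ 1^ k ++ O ∷ O ∷ I ∷ 1^ k ++ X ∷ X ∷ 1^ k ++ I ∷ O ∷ []))
  long-refinement = long separation (trans (letters-downs-only-end k k _) (cong (λ w → 1^ k ++ O ∷ O ∷ w)
    (trans (letters-ups-only-end k 0 k _) (trans (1^-++ k) (cong (λ w → I ∷ 1^ k ++ X ∷ X ∷ w)
      (trans (cong (I ∷_) (letters-arm-only-end k)) (sym (1^-++ k))))))))

module Family₅ (k : ℕ) where

  shape : Shape (every-third k)
  shape = record
    { pre = (O , 3) ∷ (I , 2) ∷ (I , 1) ∷ [] ; mid = [] ; inner = [] ; outer = [] ; zᵒ = 2 ; xᵒ = 1
    ; NoX-pre = refl ∷ refl ∷ refl ∷ [] ; NoX-mid = [] ; NoX-inner = [] ; NoX-outer = []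
    }

  plan : Plan shape
  plan = record
    { s = 2 ; t₀ = 1 ; B = 2 ; M = 4 ; top = top
    ; along = centre 2 (2 ∷ 2 ∷ []) false refl refl refl refl refl ,
        centre 1 (3 ∷ 1 ∷ 2 ∷ []) true refl refl refl refl refl ,
        centre 0 (2 ∷ 0 ∷ 1 ∷ []) false refl refl refl refl refl ,
        along-arms (s≤s (s≤s z≤n)) (λ p h →
        centre 0 (0 ∷ 1 ∷ 2 ∷ []) false (far 0 h) refl refl refl refl ,
        centre 0 (1 ∷ 0 ∷ 2 ∷ []) false (far 1 h) refl refl refl refl ,
        along-arm (≤-trans h (m≤n+m p 2)))
    ; good-0 = centre 1 (3 ∷ 1 ∷ 1 ∷ []) false refl refl refl refl refl
    ; back = refl ; total = refl ; 2≤B = from-yes (2 ≤? 2) ; B≤M = from-yes (2 ≤? 4)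
    ; 0<xᵒ = z<s ; xᵒ<B = from-yes (1 <? 2) ; z<M = from-yes (2 <? 4) ; s≤pre = from-yes (2 ≤? 3)
    ; late-pre = from-yes (1 <? 2) ∷ []
    ; late-mid = []
    ; pre-<M = from-yes (3 <? 4) ∷ from-yes (2 <? 4) ∷ from-yes (1 <? 4) ∷ []
    }
    where
    -- The level of offset 3 is alone with its label and moves the partner of level 0 to level 2.
    -- Level 0 sees offset 1 at both X levels, level 2 only at its successor.
    top = by-offset (mark 1 1) (mark 1 2) (mark 0 0)
    open Rules (every-third k) 2 top

  separation : Separation plan
  separation = record
    { start = Plan.start-degrees plan (λ _ → refl) refl
    ; sᵒ = 1 ; τ-s = refl ; top-≢ = λ ()
    ; coarse = coarse
    ; settled = every-third-settled k
    ; before-s = before-s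
    ; mate-s = 0 , z<s , (λ ()) , refl
    ; X-label = λ ()
    }
    where
    open Shape shape
    coarse : ∀ i → ∃ λ q → q < length Ξ × suc (k * 3) < τ q × third i ≡ third (τ q)
    coarse i with third i
    ... | true  = 1 , s<s z<s , n≤1+n _ , sym (third-+ k 3)
    ... | false = 0 , z<s , ≤-refl , sym (third-+ k 2)
    beyond : ∀ {q j} → 2 < q → q < length Ξ → j + (2 + k * 3) ≢ τ q
    beyond {j = j} h l e = <⇒≱ (Plan.late plan h l) (subst (2 + k * 3 ≤_) e (m≤n+m (2 + k * 3) j))
    before-s : ∀ {p q} → p < 2 → q < length Ξ → τ p ≡ τ q → p ≡ q ⊎ q ≡ 2
    before-s {0} {0} _ _ _ = inj₁ refl
    before-s {0} {1} _ _ e = ⊥-elim (1+n≢n (sym e))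
    before-s {_} {2} _ _ _ = inj₂ refl
    before-s {0} {suc (suc (suc q))} _ l e = ⊥-elim (beyond {j = 0} (s≤s (s≤s z<s)) l e)
    before-s {1} {0} _ _ e = ⊥-elim (1+n≢n e)
    before-s {1} {1} _ _ _ = inj₁ refl
    before-s {1} {suc (suc (suc q))} _ l e = ⊥-elim (beyond {j = 1} (s≤s (s≤s z<s)) l e)
    before-s {suc (suc _)} (s≤s (s≤s ()))

  long-refinement : LongRefinement (G (S ∷ O ∷ I ∷ I ∷ ((O ∷ I ∷ I ∷ []) ^^ k) ++ O ∷ O ∷ ((I ∷ I ∷ O ∷ []) ^^ k)
    ++ X ∷ X ∷ ((O ∷ I ∷ I ∷ []) ^^ k) ++ O ∷ []))
  long-refinement = long separation (cong (λ w → O ∷ I ∷ I ∷ w)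
    (trans (letters-downs-every-third k k _) (cong (λ w → ((O ∷ I ∷ I ∷ []) ^^ k) ++ O ∷ O ∷ w)
    (trans (letters-ups-every-third k 0 k _)
      (cong (λ w → ((I ∷ I ∷ O ∷ []) ^^ k) ++ X ∷ X ∷ w) (letters-arm-every-third k))))))

module Family₆ (k : ℕ) where

  shape : Shape (every-third k)
  shape = record
    { pre = [] ; mid = (I , 1) ∷ [] ; inner = (O , 3) ∷ [] ; outer = (I , 1) ∷ [] ; zᵒ = 1 ; xᵒ = 2
    ; NoX-pre = [] ; NoX-mid = refl ∷ [] ; NoX-inner = refl ∷ [] ; NoX-outer = refl ∷ []
    }

  plan : Plan shape
  plan = record
    { s = 0 ; t₀ = 1 ; B = 4 ; M = 4 ; top = top
    ; along = along-arms z≤n (λ p h →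
        centre 0 (0 ∷ 2 ∷ 1 ∷ []) false (far 0 h) refl refl refl refl ,
        centre 1 (1 ∷ 3 ∷ 1 ∷ []) false (far 1 h) refl refl refl refl ,
        centre 2 (2 ∷ 2 ∷ []) false (far 2 h) refl refl refl refl ,
        centre 1 (3 ∷ 1 ∷ 1 ∷ []) false (far 3 h) refl refl refl refl ,
        centre 0 (2 ∷ 0 ∷ 1 ∷ []) false (far 4 h) refl refl refl refl ,
        along-arm (≤-trans h (m≤n+m p 5)))
    ; good-0 = centre 0 (0 ∷ 2 ∷ 2 ∷ []) true refl refl refl refl refl
    ; back = refl ; total = refl ; 2≤B = from-yes (2 ≤? 4) ; B≤M = from-yes (4 ≤? 4)
    ; 0<xᵒ = z<s ; xᵒ<B = from-yes (2 <? 4) ; z<M = from-yes (1 <? 4) ; s≤pre = from-yes (0 ≤? 0)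
    ; late-pre = []
    ; late-mid = from-yes (1 <? 4) ∷ []
    ; pre-<M = []
    }
    where
    -- Level 0 sees the offsets 0, 2, 2, whereas the other levels of offset 1 have letter 1 and see
    -- themselves across the rung. The letter 0 between the X levels sees only offset 2.
    top = by-offset (mark 0 1) (mark 2 2) (mark 0 0)
    open Rules (every-third k) 0 top

  separation : Separation plan
  separation = record
    { start = Plan.start-degrees plan (λ _ → refl) refl
    ; sᵒ = 0 ; τ-s = refl ; top-≢ = λ ()
    ; coarse = coarse
    ; settled = every-third-settled k
    ; before-s = λ ()
    ; mate-s = Plan.mate-0 plan (from-yes (1 <? 4))
    ; X-label = λ _ → refl ∷ refl ∷ refl ∷ []
    }
    where
    open Shape shape
    coarse : ∀ i → ∃ λ q → q < length Ξ × suc (k * 3) < τ q × third i ≡ third (τ q)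
    coarse i with third i
    ... | true  = let q , q< , _ , e = Plan.seek plan {3 + k * 3} ≤-refl in
      q , q< , subst (suc (k * 3) <_) (sym e) (n≤1+n _) , sym (trans (cong third e) (third-+ k 3))
    ... | false = let q , q< , _ , e = Plan.seek plan {2 + k * 3} (n≤1+n _) in
      q , q< , subst (suc (k * 3) <_) (sym e) ≤-refl , sym (trans (cong third e) (third-+ k 2))

  long-refinement : LongRefinement (G (S ∷ ((O ∷ I ∷ I ∷ []) ^^ k) ++ O ∷ O ∷ ((I ∷ I ∷ O ∷ []) ^^ k)
    ++ I ∷ X ∷ O ∷ X ∷ I ∷ ((O ∷ I ∷ I ∷ []) ^^ k) ++ O ∷ []))
  long-refinement = long separation (trans (letters-downs-every-third k k _) (cong (λ w → ((O ∷ I ∷ I ∷ []) ^^ k) ++ O ∷ O ∷ w)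
    (trans (letters-ups-every-third k 0 k _)
      (cong (λ w → ((I ∷ I ∷ O ∷ []) ^^ k) ++ I ∷ X ∷ O ∷ X ∷ I ∷ w) (letters-arm-every-third k)))))

theorem19 : LongRefinement (G (S ∷ O ∷ I ∷ I ∷ X ∷ X ∷ []))
    × (∀ (k : ℕ) → LongRefinement (G
    (S ∷ 1^ k ++ O ∷ O ∷ 1^ k ++ X ∷ I ∷ X ∷ 1^ k ++ O ∷ [])))
    × (∀ (k : ℕ) → LongRefinement (G
    (S ∷ 1^ k ++ I ∷ I ∷ O ∷ O ∷ 1^ k ++ X ∷ X ∷ 1^ k ++ O ∷ [])))
    × (∀ (k : ℕ) → LongRefinement (G
    (S ∷ 1^ k ++ O ∷ O ∷ I ∷ 1^ k ++ X ∷ X ∷ 1^ k ++ I ∷ O ∷ [])))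
    × (∀ (k : ℕ) → LongRefinement (G
    (S ∷ O ∷ I ∷ I ∷ ((O ∷ I ∷ I ∷ []) ^^ k) ++ O ∷ O ∷ ((I ∷ I ∷ O ∷ []) ^^ k)
    ++ X ∷ X ∷ ((O ∷ I ∷ I ∷ []) ^^ k) ++ O ∷ [])))
    × (∀ (k : ℕ) → LongRefinement (G
    (S ∷ ((O ∷ I ∷ I ∷ []) ^^ k) ++ O ∷ O ∷ ((I ∷ I ∷ O ∷ []) ^^ k)
    ++ I ∷ X ∷ O ∷ X ∷ I ∷ ((O ∷ I ∷ I ∷ []) ^^ k) ++ O ∷ [])))
theorem19 =
    Run.long-refinement Family₁.schedule
  , Family₂.long-refinement
  , Family₃.long-refinement
  , Family₄.long-refinement
  , Family₅.long-refinement
  , Family₆.long-refinement
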